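{- For every positive integer $n$ there exist constants $C(n)>0$ and $c(n)>0$, depending only on $n$, such that the following holds for every finite field $\mathbb{F}_q$. If $A\subseteq M_n(\mathbb{F}_q)$ satisfies $|A|\geq C(n)q^{n^2-1}$, then $$ \max\{|A+A|, |AA|\}\geq c(n) \min\left\{\frac{|A|^2}{q^{n^2-\frac{n+1}{4}}}, q^{n^2/3}|A|^{2/3}\right\}. $$
   Context: $\mathbb{F}_q$ denotes the finite field with $q$ elements and $M_n(\mathbb{F}_q)$ the ring of $n\times n$ matrices over $\mathbb{F}_q$. $A+A=\{a+a':a,a'\in A\}$ and $AA=\{aa':a,a'\in A\}$ (matrix product). The paper's $\gtrsim$ means inequality up to a positive constant depending only on $n$, not on $q$. -}

module Defs where

open import Level using (0ℓ)
open import Algebra.Bundles using (CommutativeRing)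
open import Data.Nat as ℕ using (ℕ; zero; suc)
open import Data.Fin using (Fin)
open import Data.Fin.Properties using (all?)
open import Data.List as List using (List; length; deduplicate; concatMap; map)
open import Data.List.Relation.Unary.Any using (Any)
open import Data.List.Relation.Unary.AllPairs using (AllPairs)
open import Data.Product using (∃; _,_)
open import Relation.Nullary using (¬_; Dec; yes; no)
open import Relation.Binary using (Decidable)

record FiniteField : Set₁ where
  field
    commRing : CommutativeRing 0ℓ 0ℓ
  open CommutativeRing commRing public hiding (ring)
  field
    _≟_        : Decidable _≈_
    1≉0        : ¬ (1# ≈ 0#)
    inverse    : ∀ x → ¬ (x ≈ 0#) → ∃ λ y → (x * y) ≈ 1#
    elements   : List Carrier
    complete   : ∀ x → Any (x ≈_) elements
    distinct   : AllPairs (λ x y → ¬ (x ≈ y)) elements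

  order : ℕ
  order = length elements

module Matrices (F : FiniteField) (n : ℕ) where
  open FiniteField F

  Mat : Set
  Mat = Fin n → Fin n → Carrier

  _≈M_ : Mat → Mat → Set
  X ≈M Y = ∀ i j → X i j ≈ Y i j

  _≟M_ : Decidable _≈M_
  X ≟M Y = all? (λ i → all? (λ j → X i j ≟ Y i j))

  sumFin : ∀ {m} → (Fin m → Carrier) → Carrier
  sumFin {zero}  f = 0#
  sumFin {suc m} f = f Fin.zero + sumFin (λ k → f (Fin.suc k))
    where import Data.Fin as Fin

  _+M_ : Mat → Mat → Mat
  (X +M Y) i j = X i j + Y i j

  _*M_ : Mat → Mat → Mat
  (X *M Y) i j = sumFin (λ k → X i k * Y k j)

  -- A finite subset of M_n(F) is a duplicate-free list of matrices.
  IsSet : List Mat → Set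
  IsSet A = AllPairs (λ X Y → ¬ (X ≈M Y)) A

  card : List Mat → ℕ
  card = length

  image₂ : (Mat → Mat → Mat) → List Mat → List Mat
  image₂ _op_ A = deduplicate _≟M_ (concatMap (λ a → map (λ a' → a op a') A) A)

  sumsetSize : List Mat → ℕ
  sumsetSize A = length (image₂ _+M_ A)

  prodsetSize : List Mat → ℕ
  prodsetSize A = length (image₂ _*M_ A)

{-# OPTIONS --safe #-}
module Submission where

-- Let B ⊆ A consist of the b for which v ↦ v b is injective; since A is large and singular
-- matrices are rare, |A| ≤ 2 |B|.  Count the solutions of c b + p = s b with c ∈ A, p ∈ AA,
-- b ∈ B, s ∈ A + A.  Every triple (a, b, c) gives the solution p = a b, s = a + c, so there are
-- at least |A|² |B| of them.  Conversely, the affine maps x ↦ c x + p on row vectors c, p are a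
-- universal hash family: for (c, p) ≠ (c′, p′) at most a q⁻ⁿ fraction of all x collide.
-- Treating the n rows of the matrix equation one at a time, replacing each row by its average
-- and bounding the change by Cauchy–Schwarz and the second moment, shows that the number of
-- solutions is |A| |AA| |B| |A + A| / q^(n²) up to an error of order
-- q^(n² - n/2) (|A| |AA| |B| |A + A|)^½.  According to which term dominates, one gets
-- max ≳ q^(n²/2) |A|^½ or max ≳ |A|² / q^(n² - n/2); these imply the two alternatives.

open import Defs

-- The rows are averaged singly because the map (C, P) ↦ C b + P on whole matrices is not universal:
-- if C - C′ has rank r, its values at a random b may collide with probability q^(-rn), far above
-- q^(-n²) when r is small. One row of C - C′ is either zero or of rank one, so the row map is
-- universal, with values in a set of size v = q^n. The price is a constant factor per row,
-- collected in `κ n`. The multipliers come from B because s ↦ s b must be injective at two places: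
-- the pairs (b, s b) have to be distinct, so that their indicator has small square norm, and the
-- |A| solutions over a fixed (b, c) have to be distinct. Nothing is divided: each averaged row
-- multiplies the count by v, so v^n T is compared with an integer W. For the end: M² ≳ q^(n²) |A|
-- together with M ≥ |A + A| ≥ |A| gives M³ ≳ q^(n²) |A|², and n/2 ≥ (n+1)/4 for n ≥ 1.

module Sums where
  open import Data.Bool using (if_then_else_)
  open import Data.Integer using (ℤ; +_; 0ℤ; 1ℤ; _+_; _*_; _-_; -_; _≤_; +≤+; nonNegative)
  open import Data.Integer.Properties hiding (_≟_)
  open import Data.Integer.Tactic.RingSolver using (solve-∀)
  open import Data.List using (List; []; _∷_; _++_; map; length; cartesianProductWith; cartesianProduct; allFin)
  open import Data.List.Relation.Unary.All as All using (All; []; _∷_)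
  open import Data.List.Relation.Unary.Any using (here; there)
  open import Data.List.Relation.Unary.AllPairs using ([]; _∷_)
  open import Data.List.Relation.Unary.Unique.Propositional using (Unique)
  import Data.List.Relation.Unary.Unique.Propositional.Properties as Unique
  open import Data.List.Membership.Propositional using (_∈_)
  open import Data.List.Membership.Propositional.Properties using (∈-allFin; ∈-cartesianProductWith⁺; ∈-cartesianProduct⁺)
  open import Data.Nat using (ℕ; zero; suc; z≤n)
  open import Data.Fin using (Fin)
  import Data.Fin.Properties as Fin
  open import Data.Vec using (Vec; []; _∷_)
  import Data.Vec.Properties as Vec
  open import Data.Product using (_×_; _,_)
  import Data.Product.Properties as Product
  open import Data.Empty using (⊥-elim)
  open import Relation.Nullary using (Dec; yes; no; does; ¬_)
  open import Relation.Binary using (DecidableEquality)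
  open import Relation.Binary.PropositionalEquality

  private variable
    A B C : Set

  -- Integer inequalities, finite sums and finite types

  *-monoˡ : ∀ {a b c} → 0ℤ ≤ a → b ≤ c → a * b ≤ a * c
  *-monoˡ {a} 0≤a = *-monoˡ-≤-nonNeg a {{nonNegative 0≤a}}

  *-monoʳ : ∀ {a b c} → 0ℤ ≤ a → b ≤ c → b * a ≤ c * a
  *-monoʳ {a} 0≤a = *-monoʳ-≤-nonNeg a {{nonNegative 0≤a}}

  *-nonNeg : ∀ {a b} → 0ℤ ≤ a → 0ℤ ≤ b → 0ℤ ≤ a * b
  *-nonNeg {a} {b} 0≤a 0≤b = subst (_≤ a * b) (*-zeroʳ a) (*-monoˡ 0≤a 0≤b)

  *-mono : ∀ {a b c d} → 0ℤ ≤ a → 0ℤ ≤ d → a ≤ b → c ≤ d → a * c ≤ b * d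
  *-mono 0≤a 0≤d a≤b c≤d = ≤-trans (*-monoˡ 0≤a c≤d) (*-monoʳ 0≤d a≤b)

  0≤sq : ∀ a → 0ℤ ≤ a * a
  0≤sq (+ zero)       = +≤+ z≤n
  0≤sq (+ suc n)      = +≤+ z≤n
  0≤sq (ℤ.negsuc n)   = +≤+ z≤n

  0≤+ : ∀ {n} → 0ℤ ≤ + n
  0≤+ = +≤+ z≤n

  ∑ : List A → (A → ℤ) → ℤ
  ∑ []       f = 0ℤ
  ∑ (x ∷ xs) f = f x + ∑ xs f

  ∑-cong : ∀ (xs : List A) {f g : A → ℤ} → (∀ x → f x ≡ g x) → ∑ xs f ≡ ∑ xs g
  ∑-cong []       f≗g = refl
  ∑-cong (x ∷ xs) f≗g = cong₂ _+_ (f≗g x) (∑-cong xs f≗g)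

  ∑-mono-∈ : ∀ (xs : List A) {f g : A → ℤ} → (∀ {x} → x ∈ xs → f x ≤ g x) → ∑ xs f ≤ ∑ xs g
  ∑-mono-∈ []       f≤g = ≤-refl
  ∑-mono-∈ (x ∷ xs) f≤g = +-mono-≤ (f≤g (here refl)) (∑-mono-∈ xs (λ x∈xs → f≤g (there x∈xs)))

  ∑-mono : ∀ (xs : List A) {f g : A → ℤ} → (∀ x → f x ≤ g x) → ∑ xs f ≤ ∑ xs g
  ∑-mono xs f≤g = ∑-mono-∈ xs (λ {x} _ → f≤g x)

  ∑-zero : ∀ (xs : List A) → ∑ xs (λ _ → 0ℤ) ≡ 0ℤ
  ∑-zero []       = refl
  ∑-zero (x ∷ xs) = trans (+-identityˡ _) (∑-zero xs)

  ∑-nonNeg : ∀ (xs : List A) {f : A → ℤ} → (∀ x → 0ℤ ≤ f x) → 0ℤ ≤ ∑ xs f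
  ∑-nonNeg xs {f} 0≤f = subst (_≤ ∑ xs f) (∑-zero xs) (∑-mono xs 0≤f)

  ∑-distrib-+ : ∀ (xs : List A) (f g : A → ℤ) → ∑ xs (λ x → f x + g x) ≡ ∑ xs f + ∑ xs g
  ∑-distrib-+ []       f g = refl
  ∑-distrib-+ (x ∷ xs) f g = trans (cong (_+_ (f x + g x)) (∑-distrib-+ xs f g)) (lemma (f x) (g x) _ _)
    where
    lemma : ∀ a b c d → a + b + (c + d) ≡ a + c + (b + d)
    lemma = solve-∀

  ∑-distribˡ-* : ∀ (xs : List A) c (f : A → ℤ) → ∑ xs (λ x → c * f x) ≡ c * ∑ xs f
  ∑-distribˡ-* []       c f = sym (*-zeroʳ c)
  ∑-distribˡ-* (x ∷ xs) c f = trans (cong (_+_ (c * f x)) (∑-distribˡ-* xs c f)) (sym (*-distribˡ-+ c _ _))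

  ∑-distribʳ-* : ∀ (xs : List A) c (f : A → ℤ) → ∑ xs (λ x → f x * c) ≡ ∑ xs f * c
  ∑-distribʳ-* xs c f = trans (∑-cong xs λ x → *-comm (f x) c) (trans (∑-distribˡ-* xs c f) (*-comm c _))

  ∑-distrib-- : ∀ (xs : List A) (f g : A → ℤ) → ∑ xs (λ x → f x - g x) ≡ ∑ xs f - ∑ xs g
  ∑-distrib-- []       f g = refl
  ∑-distrib-- (x ∷ xs) f g = trans (cong (_+_ (f x - g x)) (∑-distrib-- xs f g)) (lemma (f x) (g x) _ _)
    where
    lemma : ∀ a b c d → a - b + (c - d) ≡ a + c - (b + d)
    lemma = solve-∀

  ∑-swap : ∀ (xs : List A) (ys : List B) (f : A → B → ℤ) →
           ∑ xs (λ x → ∑ ys (f x)) ≡ ∑ ys (λ y → ∑ xs (λ x → f x y))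
  ∑-swap []       ys f = sym (∑-zero ys)
  ∑-swap (x ∷ xs) ys f = trans (cong (_+_ (∑ ys (f x))) (∑-swap xs ys f)) (sym (∑-distrib-+ ys _ _))

  ∑-++ : ∀ (xs ys : List A) f → ∑ (xs ++ ys) f ≡ ∑ xs f + ∑ ys f
  ∑-++ []       ys f = sym (+-identityˡ _)
  ∑-++ (x ∷ xs) ys f = trans (cong (_+_ (f x)) (∑-++ xs ys f)) (sym (+-assoc (f x) _ _))

  ∑-map : ∀ (h : A → B) xs f → ∑ (map h xs) f ≡ ∑ xs (λ x → f (h x))
  ∑-map h []       f = refl
  ∑-map h (x ∷ xs) f = cong (_+_ (f (h x))) (∑-map h xs f)

  ∑-cartesianProductWith : ∀ (h : A → B → C) xs ys f →
    ∑ (cartesianProductWith h xs ys) f ≡ ∑ xs (λ x → ∑ ys (λ y → f (h x y)))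
  ∑-cartesianProductWith h []       ys f = refl
  ∑-cartesianProductWith h (x ∷ xs) ys f = trans (∑-++ (map (h x) ys) _ f)
    (cong₂ _+_ (∑-map (h x) ys f) (∑-cartesianProductWith h xs ys f))

  ∑-const : ∀ (xs : List A) c → ∑ xs (λ _ → c) ≡ + length xs * c
  ∑-const []       c = refl
  ∑-const (x ∷ xs) c = trans (cong (_+_ c) (∑-const xs c)) (sym (suc-* (+ length xs) c))

  ∑-1 : ∀ (xs : List A) → ∑ xs (λ _ → 1ℤ) ≡ + length xs
  ∑-1 xs = trans (∑-const xs 1ℤ) (*-identityʳ (+ length xs))

  -- The difference of the two sides is half the double sum of (f x * g y - f y * g x)².
  cauchy-schwarz : ∀ (xs : List A) (f g : A → ℤ) →
    ∑ xs (λ x → f x * g x) * ∑ xs (λ x → f x * g x) ≤ ∑ xs (λ x → f x * f x) * ∑ xs (λ x → g x * g x)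
  cauchy-schwarz xs f g = *-cancelˡ-≤-pos _ _ (+ 2) (0≤i-j⇒j≤i (subst (0ℤ ≤_) eq nonneg))
    where
    open ≡-Reasoning
    F = ∑ xs (λ x → f x * f x)
    G = ∑ xs (λ x → g x * g x)
    S = ∑ xs (λ x → f x * g x)
    nonneg : 0ℤ ≤ ∑ xs λ x → ∑ xs λ y → (f x * g y - f y * g x) * (f x * g y - f y * g x)
    nonneg = ∑-nonNeg xs λ x → ∑-nonNeg xs λ y → 0≤sq (f x * g y - f y * g x)
    expand : ∀ a b c d → (a * d - c * b) * (a * d - c * b)
           ≡ a * a * (d * d) + b * b * (c * c) - + 2 * (a * b) * (c * d)
    expand = solve-∀
    collect : ∀ F G S → F * G + G * F - + 2 * S * S ≡ + 2 * (F * G) - + 2 * (S * S)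
    collect = solve-∀
    eq : (∑ xs λ x → ∑ xs λ y → (f x * g y - f y * g x) * (f x * g y - f y * g x))
       ≡ + 2 * (F * G) - + 2 * (S * S)
    eq = begin
      _ ≡⟨ ∑-cong xs (λ x → trans (∑-cong xs λ y → expand (f x) (g x) (f y) (g y))
             (trans (∑-distrib-- xs _ _) (cong₂ _-_
               (trans (∑-distrib-+ xs _ _) (cong₂ _+_ (∑-distribˡ-* xs (f x * f x) _) (∑-distribˡ-* xs (g x * g x) _)))
               (∑-distribˡ-* xs (+ 2 * (f x * g x)) _)))) ⟩
      ∑ xs (λ x → f x * f x * G + g x * g x * F - + 2 * (f x * g x) * S)
        ≡⟨ trans (∑-distrib-- xs _ _) (cong₂ _-_
             (trans (∑-distrib-+ xs _ _) (cong₂ _+_ (∑-distribʳ-* xs G _) (∑-distribʳ-* xs F _)))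
             (trans (∑-distribʳ-* xs S _) (cong (_* S) (∑-distribˡ-* xs (+ 2) _)))) ⟩
      F * G + G * F - + 2 * S * S ≡⟨ collect F G S ⟩
      _ ∎

  ∑-square≤ : ∀ (xs : List A) f → ∑ xs f * ∑ xs f ≤ + length xs * ∑ xs (λ x → f x * f x)
  ∑-square≤ xs f = subst₂ _≤_ (cong₂ _*_ eq eq) (cong (_* ∑ xs (λ x → f x * f x)) (∑-1 xs))
    (cauchy-schwarz xs (λ _ → 1ℤ) f)
    where
    eq : ∑ xs (λ x → 1ℤ * f x) ≡ ∑ xs f
    eq = ∑-cong xs λ x → *-identityˡ (f x)

  𝟙 : {P : Set} → Dec P → ℤ
  𝟙 d = if does d then 1ℤ else 0ℤ

  𝟙-yes : ∀ {P : Set} (d : Dec P) → P → 𝟙 d ≡ 1ℤ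
  𝟙-yes (yes _) _ = refl
  𝟙-yes (no ¬p) p = ⊥-elim (¬p p)

  𝟙-no : ∀ {P : Set} (d : Dec P) → ¬ P → 𝟙 d ≡ 0ℤ
  𝟙-no (yes p) ¬p = ⊥-elim (¬p p)
  𝟙-no (no _)  _  = refl

  0≤𝟙 : ∀ {P : Set} (d : Dec P) → 0ℤ ≤ 𝟙 d
  0≤𝟙 (yes _) = 0≤+
  0≤𝟙 (no _)  = 0≤+

  𝟙≤1 : ∀ {P : Set} (d : Dec P) → 𝟙 d ≤ 1ℤ
  𝟙≤1 (yes _) = ≤-refl
  𝟙≤1 (no _)  = 0≤+

  𝟙-mono : ∀ {P Q : Set} (d : Dec P) (e : Dec Q) → (P → Q) → 𝟙 d ≤ 𝟙 e
  𝟙-mono (yes p) e       f = ≤-reflexive (sym (𝟙-yes e (f p)))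
  𝟙-mono (no _)  e       f = 0≤𝟙 e

  ∑-𝟙-∈ : ∀ {P : A → Set} (P? : ∀ x → Dec (P x)) {x} xs → x ∈ xs → P x → 1ℤ ≤ ∑ xs (λ x → 𝟙 (P? x))
  ∑-𝟙-∈ P? (x ∷ xs) (here refl)  Px = subst (_≤ 𝟙 (P? x) + ∑ xs (λ x → 𝟙 (P? x))) (+-identityʳ 1ℤ)
    (+-mono-≤ (≤-reflexive (sym (𝟙-yes (P? x) Px))) (∑-nonNeg xs λ x → 0≤𝟙 (P? x)))
  ∑-𝟙-∈ P? (y ∷ xs) (there x∈xs) Px = subst (_≤ 𝟙 (P? y) + ∑ xs (λ x → 𝟙 (P? x))) (+-identityˡ 1ℤ)
    (+-mono-≤ (0≤𝟙 (P? y)) (∑-𝟙-∈ P? xs x∈xs Px))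

  -- Equality is propositional here; the setoid equality of field elements and matrices is brought
  -- into this form by coding. The cardinality is an integer because it enters subtractions.
  record Finite (A : Set) : Set where
    infix 4 _≟_
    field
      enum     : List A
      unique   : Unique enum
      complete : ∀ x → x ∈ enum
      _≟_      : DecidableEquality A

    ∣∣ : ℤ
    ∣∣ = + length enum

    private
      δ-absent : ∀ x xs (h : A → ℤ) → All (x ≢_) xs → ∑ xs (λ y → 𝟙 (x ≟ y) * h y) ≡ 0ℤ
      δ-absent x []       h []         = refl
      δ-absent x (y ∷ xs) h (x≢y ∷ x≢xs) =
        cong₂ _+_ (trans (cong (_* h y) (𝟙-no (x ≟ y) x≢y)) (*-zeroˡ (h y))) (δ-absent x xs h x≢xs)

      δ-present : ∀ x {xs} (h : A → ℤ) → Unique xs → x ∈ xs → ∑ xs (λ y → 𝟙 (x ≟ y) * h y) ≡ h x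
      δ-present x {_ ∷ xs} h (x≢ ∷ u) (here refl) =
        trans (cong₂ _+_ (trans (cong (_* h x) (𝟙-yes (x ≟ x) refl)) (*-identityˡ (h x))) (δ-absent x xs h x≢))
          (+-identityʳ (h x))
      δ-present x {y ∷ _} h (y≢ ∷ u) (there x∈xs) =
        trans (cong₂ _+_ (trans (cong (_* h y) (𝟙-no (x ≟ y) λ { refl → All.lookup y≢ x∈xs refl })) (*-zeroˡ (h y)))
                         (δ-present x h u x∈xs))
          (+-identityˡ (h x))

    ∑-δ : ∀ x (h : A → ℤ) → ∑ enum (λ y → 𝟙 (x ≟ y) * h y) ≡ h x
    ∑-δ x h = δ-present x h unique (complete x)

    -- The multiplicity function of a list: it turns a list of points into a weight on the whole
    -- type, the form in which the hashing estimates are stated.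
    count : List A → A → ℤ
    count l x = ∑ l (λ z → 𝟙 (z ≟ x))

    0≤count : ∀ l x → 0ℤ ≤ count l x
    0≤count l x = ∑-nonNeg l λ z → 0≤𝟙 (z ≟ x)

    ∑-count : ∀ l (h : A → ℤ) → ∑ enum (λ x → count l x * h x) ≡ ∑ l h
    ∑-count l h = begin
      ∑ enum (λ x → count l x * h x)                  ≡⟨ ∑-cong enum (λ x → sym (∑-distribʳ-* l (h x) _)) ⟩
      ∑ enum (λ x → ∑ l (λ z → 𝟙 (z ≟ x) * h x))      ≡⟨ ∑-swap enum l _ ⟩
      ∑ l (λ z → ∑ enum (λ x → 𝟙 (z ≟ x) * h x))      ≡⟨ ∑-cong l (λ z → ∑-δ z h) ⟩
      ∑ l h                                           ∎
      where open ≡-Reasoning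

    count-∉ : ∀ {x} l → All (x ≢_) l → count l x ≡ 0ℤ
    count-∉ []      []         = refl
    count-∉ (y ∷ l) (x≢y ∷ x≢) = cong₂ _+_ (𝟙-no (y ≟ _) λ y≡x → x≢y (sym y≡x)) (count-∉ l x≢)

    count-∈ : ∀ {x} l → x ∈ l → 1ℤ ≤ count l x
    count-∈ {x} l x∈l = ∑-𝟙-∈ (_≟ x) l x∈l refl

    count-unique≤ : ∀ {l} l′ x → Unique l → (∀ {z} → z ∈ l → z ∈ l′) → count l x ≤ count l′ x
    count-unique≤ {[]}    l′ x []       l⊆l′ = 0≤count l′ x
    count-unique≤ {y ∷ l} l′ x (y≢ ∷ u) l⊆l′ with y ≟ x
    ... | yes refl = subst (_≤ count l′ x) (sym (trans (cong (_+_ 1ℤ) (count-∉ l y≢)) (+-identityʳ 1ℤ)))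
                       (count-∈ l′ (l⊆l′ (here refl)))
    ... | no  _    = subst (_≤ count l′ x) (sym (+-identityˡ _)) (count-unique≤ l′ x u (λ z∈l → l⊆l′ (there z∈l)))

    count-unique≤1 : ∀ {l} x → Unique l → count l x ≤ 1ℤ
    count-unique≤1 {[]}    x []       = 0≤+
    count-unique≤1 {y ∷ l} x (y≢ ∷ u) with y ≟ x
    ... | yes refl = ≤-reflexive (trans (cong (_+_ 1ℤ) (count-∉ l y≢)) (+-identityʳ 1ℤ))
    ... | no  _    = subst (_≤ 1ℤ) (sym (+-identityˡ _)) (count-unique≤1 x u)

    -- A sum over a list sees only multiplicities, and those of a duplicate-free list are at most
    -- one, so inclusion of members is enough. Repetitions in `l′` only help.
    ∑-unique≤ : ∀ {l} l′ {h} → (∀ x → 0ℤ ≤ h x) → Unique l → (∀ {z} → z ∈ l → z ∈ l′) → ∑ l h ≤ ∑ l′ h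
    ∑-unique≤ {l} l′ {h} 0≤h u l⊆l′ = subst₂ _≤_ (∑-count l h) (∑-count l′ h)
      (∑-mono enum λ x → *-monoʳ (0≤h x) (count-unique≤ l′ x u l⊆l′))

    -- Without duplicates the multiplicity function is an indicator, so its square norm is
    -- controlled by the number of points.
    ∑-count² : ∀ {l} → Unique l → ∑ enum (λ x → count l x * count l x) ≤ + length l
    ∑-count² {l} u = ≤-trans (≤-reflexive (∑-count l (count l)))
      (subst (∑ l (count l) ≤_) (∑-1 l) (∑-mono l λ x → count-unique≤1 x u))

    ∑-𝟙-unique≤1 : ∀ {P : A → Set} (P? : ∀ x → Dec (P x)) → (∀ {x y} → P x → P y → x ≡ y) →
                   ∑ enum (λ x → 𝟙 (P? x)) ≤ 1ℤ
    ∑-𝟙-unique≤1 {P} P? P! = go unique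
      where
      none : ∀ {x l} → P x → All (x ≢_) l → ∑ l (λ x → 𝟙 (P? x)) ≡ 0ℤ
      none Px []         = refl
      none Px (x≢y ∷ x≢) = cong₂ _+_ (𝟙-no (P? _) λ Py → x≢y (P! Px Py)) (none Px x≢)
      go : ∀ {l} → Unique l → ∑ l (λ x → 𝟙 (P? x)) ≤ 1ℤ
      go []                 = 0≤+
      go {x ∷ l} (x≢ ∷ u) with P? x
      ... | yes Px = ≤-reflexive (trans (cong (_+_ 1ℤ) (none Px x≢)) (+-identityʳ 1ℤ))
      ... | no  _  = subst (_≤ 1ℤ) (sym (+-identityˡ _)) (go u)

  open Finite

  finFinite : ∀ n → Finite (Fin n)
  finFinite n = record { enum = allFin n ; unique = Unique.allFin⁺ n ; complete = ∈-allFin ; _≟_ = Fin._≟_ }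

  productFinite : Finite A → Finite B → Finite (A × B)
  productFinite a b = record
    { enum     = cartesianProduct (enum a) (enum b)
    ; unique   = Unique.cartesianProduct⁺ (unique a) (unique b)
    ; complete = λ { (x , y) → ∈-cartesianProduct⁺ (complete a x) (complete b y) }
    ; _≟_      = Product.≡-dec (_≟_ a) (_≟_ b)
    }

  vecFinite : Finite A → ∀ m → Finite (Vec A m)
  vecFinite a zero = record
    { enum = [] ∷ [] ; unique = [] ∷ [] ; complete = λ { [] → here refl } ; _≟_ = Vec.≡-dec (_≟_ a) }
  vecFinite a (suc m) = record
    { enum     = cartesianProductWith _∷_ (enum a) (enum (vecFinite a m))
    ; unique   = Unique.cartesianProductWith⁺ _∷_ Vec.∷-injective (unique a) (unique (vecFinite a m))
    ; complete = λ { (x ∷ v) → ∈-cartesianProductWith⁺ _∷_ (complete a x) (complete (vecFinite a m) v) }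
    ; _≟_      = Vec.≡-dec (_≟_ a)
    }

  ∑-vec : ∀ (a : Finite A) m (h : Vec A (suc m) → ℤ) →
    ∑ (enum (vecFinite a (suc m))) h ≡ ∑ (enum a) (λ x → ∑ (enum (vecFinite a m)) (λ v → h (x ∷ v)))
  ∑-vec a m h = ∑-cartesianProductWith _∷_ (enum a) _ h

  ∑-product : ∀ (a : Finite A) (b : Finite B) (h : A × B → ℤ) →
    ∑ (enum (productFinite a b)) h ≡ ∑ (enum a) (λ x → ∑ (enum b) (λ y → h (x , y)))
  ∑-product a b h = ∑-cartesianProductWith _,_ (enum a) (enum b) h

  ∣product∣ : ∀ (a : Finite A) (b : Finite B) → ∣∣ (productFinite a b) ≡ ∣∣ a * ∣∣ b
  ∣product∣ a b = trans (sym (∑-1 (enum (productFinite a b)))) (trans (∑-product a b (λ _ → 1ℤ))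
    (trans (∑-cong (enum a) λ _ → ∑-1 (enum b)) (∑-const (enum a) (∣∣ b))))

  ∣vec∣ : ∀ (a : Finite A) m → ∣∣ (vecFinite a (suc m)) ≡ ∣∣ a * ∣∣ (vecFinite a m)
  ∣vec∣ a m = trans (sym (∑-1 (enum (vecFinite a (suc m))))) (trans (∑-vec a m (λ _ → 1ℤ))
    (trans (∑-cong (enum a) λ _ → ∑-1 (enum (vecFinite a m))) (∑-const (enum a) (∣∣ (vecFinite a m)))))

-- Equidistribution of universal hash families

module Hashing where
  open Sums
  open Finite using (enum; ∣∣; _≟_)
  open import Data.Integer using (ℤ; +_; 0ℤ; 1ℤ; _+_; _*_; _-_; -_; _≤_; _^_)
  open import Data.Integer.Properties hiding (_≟_)
  open import Data.Integer.Tactic.RingSolver using (solve-∀)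
  open import Data.List using (List; cartesianProduct)
  open import Data.Nat using (ℕ; zero; suc)
  open import Data.Vec using (Vec; []; _∷_; map)
  open import Data.Product using (_×_; _,_)
  open import Relation.Nullary using (yes; no)
  open import Relation.Binary.PropositionalEquality

  0≤^ : ∀ {a} m → 0ℤ ≤ a → 0ℤ ≤ a ^ m
  0≤^ zero    0≤a = 0≤+
  0≤^ (suc m) 0≤a = *-nonNeg 0≤a (0≤^ m 0≤a)

  -- Each row adds one use of (a + b)² ≤ 2 a² + 2 b².
  κ : ℕ → ℤ
  κ zero    = 0ℤ
  κ (suc m) = + 2 * (1ℤ + κ m)

  0≤κ : ∀ m → 0ℤ ≤ κ m
  0≤κ zero    = 0≤+
  0≤κ (suc m) = *-nonNeg {+ 2} 0≤+ (+-mono-≤ {0ℤ} {1ℤ} 0≤+ (0≤κ m))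

  -- φ is a universal hash family: two distinct r, r′ collide for at most a 1/v fraction of the x.
  module UniversalHash
    {R X V : Set} (finR : Finite R) (finX : Finite X) (finV : Finite V)
    (φ : R → X → V) (k : ℤ) (0≤k : 0ℤ ≤ k)
    (fibre≤ : ∀ x s → ∑ (enum finR) (λ r → 𝟙 (_≟_ finV (φ r x) s)) ≤ k)
    (collision≤ : ∀ {r r′} → r ≢ r′ → ∣∣ finV * ∑ (enum finX) (λ x → 𝟙 (_≟_ finV (φ r x) (φ r′ x))) ≤ ∣∣ finX)
    (∣R∣≤ : ∣∣ finR ≤ k * ∣∣ finV)
    where

    open Finite finR using () renaming (enum to Rs; ∣∣ to ∣R∣; _≟_ to _≟R_)
    open Finite finX using () renaming (enum to Xs; ∣∣ to ∣X∣)
    open Finite finV using () renaming (enum to Vs; ∣∣ to v; _≟_ to _≟V_)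

    Rⁿ : ∀ m → List (Vec R m)
    Rⁿ m = enum (vecFinite finR m)

    Vⁿ : ∀ m → List (Vec V m)
    Vⁿ m = enum (vecFinite finV m)

    φ* : ∀ {m} → Vec R m → X → Vec V m
    φ* w x = map (λ r → φ r x) w

    ∑-fibre≤ : ∀ x (h : V → ℤ) → (∀ s → 0ℤ ≤ h s) → ∑ Rs (λ r → h (φ r x)) ≤ k * ∑ Vs h
    ∑-fibre≤ x h 0≤h = begin
      ∑ Rs (λ r → h (φ r x))                             ≡⟨ ∑-cong Rs (λ r → sym (Finite.∑-δ finV (φ r x) h)) ⟩
      ∑ Rs (λ r → ∑ Vs (λ s → 𝟙 (φ r x ≟V s) * h s))     ≡⟨ ∑-swap Rs Vs (λ r s → 𝟙 (φ r x ≟V s) * h s) ⟩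
      ∑ Vs (λ s → ∑ Rs (λ r → 𝟙 (φ r x ≟V s) * h s))     ≡⟨ ∑-cong Vs (λ s → ∑-distribʳ-* Rs (h s) (λ r → 𝟙 (φ r x ≟V s))) ⟩
      ∑ Vs (λ s → ∑ Rs (λ r → 𝟙 (φ r x ≟V s)) * h s)     ≤⟨ ∑-mono Vs (λ s → *-monoʳ (0≤h s) (fibre≤ x s)) ⟩
      ∑ Vs (λ s → k * h s)                               ≡⟨ ∑-distribˡ-* Vs k h ⟩
      k * ∑ Vs h                                         ∎
      where open ≤-Reasoning

    -- For fixed `x` the coordinates hash independently, each at most `k` to one, so w ↦ `φ* w x` is
    -- at most `k ^ m` to one.
    ∑-fibre*≤ : ∀ m x (h : Vec V m → ℤ) → (∀ s → 0ℤ ≤ h s) → ∑ (Rⁿ m) (λ w → h (φ* w x)) ≤ k ^ m * ∑ (Vⁿ m) h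
    ∑-fibre*≤ zero    x h 0≤h = ≤-reflexive (sym (*-identityˡ (h [] + 0ℤ)))
    ∑-fibre*≤ (suc m) x h 0≤h = begin
      ∑ (Rⁿ (suc m)) (λ w → h (φ* w x))                  ≡⟨ ∑-vec finR m (λ w → h (φ* w x)) ⟩
      ∑ Rs (λ r → ∑ (Rⁿ m) (λ w → h (φ r x ∷ φ* w x)))   ≤⟨ ∑-mono Rs (λ r → ∑-fibre*≤ m x (λ s → h (φ r x ∷ s)) (λ s → 0≤h (φ r x ∷ s))) ⟩
      ∑ Rs (λ r → k ^ m * H (φ r x))                     ≡⟨ ∑-distribˡ-* Rs (k ^ m) (λ r → H (φ r x)) ⟩
      k ^ m * ∑ Rs (λ r → H (φ r x))                     ≤⟨ *-monoˡ (0≤^ m 0≤k) (∑-fibre≤ x H (λ s → ∑-nonNeg (Vⁿ m) (λ s′ → 0≤h (s ∷ s′)))) ⟩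
      k ^ m * (k * ∑ Vs H)                               ≡⟨ sym (*-assoc (k ^ m) k (∑ Vs H)) ⟩
      k ^ m * k * ∑ Vs H                                 ≡⟨ cong₂ _*_ (*-comm (k ^ m) k) (sym (∑-vec finV m h)) ⟩
      k ^ suc m * ∑ (Vⁿ (suc m)) h                       ∎
      where
      open ≤-Reasoning
      H : V → ℤ
      H s = ∑ (Vⁿ m) (λ s′ → h (s ∷ s′))

    -- The trivial bound on the diagonal is added to the universal bound instead of replacing it;
    -- then the constant part sums over all pairs to the square of the total weight.
    collisions≤ : ∀ r r′ → v * ∑ Xs (λ x → 𝟙 (φ r′ x ≟V φ r x)) ≤ ∣X∣ + 𝟙 (r ≟R r′) * (v * ∣X∣)
    collisions≤ r r′ with r ≟R r′
    ... | yes _ = begin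
      v * ∑ Xs (λ x → 𝟙 (φ r′ x ≟V φ r x)) ≤⟨ *-monoˡ {v} 0≤+ (∑-mono Xs (λ x → 𝟙≤1 (φ r′ x ≟V φ r x))) ⟩
      v * ∑ Xs (λ _ → 1ℤ)                  ≡⟨ cong (v *_) (∑-1 Xs) ⟩
      v * ∣X∣                              ≡⟨ sym (trans (+-identityˡ _) (*-identityˡ (v * ∣X∣))) ⟩
      0ℤ + 1ℤ * (v * ∣X∣)                  ≤⟨ +-monoˡ-≤ (1ℤ * (v * ∣X∣)) 0≤+ ⟩
      ∣X∣ + 1ℤ * (v * ∣X∣)                 ∎
      where open ≤-Reasoning
    ... | no r≢r′ = subst (v * ∑ Xs (λ x → 𝟙 (φ r′ x ≟V φ r x)) ≤_)
      (sym (trans (cong (_+_ ∣X∣) (*-zeroˡ (v * ∣X∣))) (+-identityʳ ∣X∣)))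
      (collision≤ λ r′≡r → r≢r′ (sym r′≡r))

    -- Second moment of a single hash value

    module _ (f : R → ℤ) where
      -- The push-forward of the weight `f` along r ↦ `φ r x`; `∑-mass` is the change of variables
      -- for it.
      mass : X → V → ℤ
      mass x s = ∑ Rs (λ r → 𝟙 (φ r x ≟V s) * f r)

      ∑-mass : ∀ x (h : V → ℤ) → ∑ Vs (λ s → mass x s * h s) ≡ ∑ Rs (λ r → f r * h (φ r x))
      ∑-mass x h = begin
        ∑ Vs (λ s → mass x s * h s)
          ≡⟨ ∑-cong Vs (λ s → sym (∑-distribʳ-* Rs (h s) (λ r → 𝟙 (φ r x ≟V s) * f r))) ⟩
        ∑ Vs (λ s → ∑ Rs (λ r → 𝟙 (φ r x ≟V s) * f r * h s))
          ≡⟨ ∑-swap Vs Rs (λ s r → 𝟙 (φ r x ≟V s) * f r * h s) ⟩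
        ∑ Rs (λ r → ∑ Vs (λ s → 𝟙 (φ r x ≟V s) * f r * h s))
          ≡⟨ ∑-cong Rs (λ r → ∑-cong Vs (λ s → *-assoc (𝟙 (φ r x ≟V s)) (f r) (h s))) ⟩
        ∑ Rs (λ r → ∑ Vs (λ s → 𝟙 (φ r x ≟V s) * (f r * h s)))
          ≡⟨ ∑-cong Rs (λ r → Finite.∑-δ finV (φ r x) (λ s → f r * h s)) ⟩
        ∑ Rs (λ r → f r * h (φ r x)) ∎
        where open ≡-Reasoning

      ∑mass≡ : ∀ x → ∑ Vs (mass x) ≡ ∑ Rs f
      ∑mass≡ x = trans (∑-cong Vs λ s → sym (*-identityʳ (mass x s)))
        (trans (∑-mass x (λ _ → 1ℤ)) (∑-cong Rs λ r → *-identityʳ (f r)))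

      -- Mass minus its mean over V, multiplied by `v` to stay integral.
      deviation : X → V → ℤ
      deviation x s = v * mass x s - ∑ Rs f

      -- The usual variance identity. The sum of squared masses becomes a weighted count of
      -- colliding pairs, through `∑-mass` applied to `mass x` itself.
      ∑-deviation² : ∀ x → ∑ Vs (λ s → deviation x s * deviation x s)
                   ≡ v * (v * ∑ Rs (λ r → f r * mass x (φ r x)) - ∑ Rs f * ∑ Rs f)
      ∑-deviation² x = begin
        ∑ Vs (λ s → deviation x s * deviation x s)
          ≡⟨ ∑-cong Vs (λ s → expand v (mass x s) t) ⟩
        ∑ Vs (λ s → v * v * (mass x s * mass x s) + (t * t - + 2 * v * t * mass x s))
          ≡⟨ ∑-distrib-+ Vs (λ s → v * v * (mass x s * mass x s)) (λ s → t * t - + 2 * v * t * mass x s) ⟩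
        ∑ Vs (λ s → v * v * (mass x s * mass x s)) + ∑ Vs (λ s → t * t - + 2 * v * t * mass x s)
          ≡⟨ cong₂ _+_ (trans (∑-distribˡ-* Vs (v * v) (λ s → mass x s * mass x s)) (cong (v * v *_) (∑-mass x (mass x))))
               (trans (∑-distrib-- Vs (λ _ → t * t) (λ s → + 2 * v * t * mass x s))
                 (cong₂ _-_ (∑-const Vs (t * t)) (trans (∑-distribˡ-* Vs (+ 2 * v * t) (mass x)) (cong (+ 2 * v * t *_) (∑mass≡ x))))) ⟩
        v * v * Q + (v * (t * t) - + 2 * v * t * t)
          ≡⟨ collect v Q t ⟩
        v * (v * Q - t * t) ∎
        where
        open ≡-Reasoning
        t = ∑ Rs f
        Q = ∑ Rs (λ r → f r * mass x (φ r x))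
        expand : ∀ v a t → (v * a - t) * (v * a - t) ≡ v * v * (a * a) + (t * t - + 2 * v * t * a)
        expand = solve-∀
        collect : ∀ v Q t → v * v * Q + (v * (t * t) - + 2 * v * t * t) ≡ v * (v * Q - t * t)
        collect = solve-∀

      module _ (0≤f : ∀ r → 0ℤ ≤ f r) where
        -- Pairs r ≠ r′ collide for at most a 1/v fraction of the x, so their total is absorbed by
        -- the squared mean that is subtracted; what survives is the diagonal. As only an upper
        -- bound on collisions is known, the pair weights must be nonnegative.
        variance≤ : ∑ Xs (λ x → ∑ Vs (λ s → deviation x s * deviation x s)) ≤ v * v * ∣X∣ * ∑ Rs (λ r → f r * f r)
        variance≤ = begin
          ∑ Xs (λ x → ∑ Vs (λ s → deviation x s * deviation x s))
            ≡⟨ trans (∑-cong Xs ∑-deviation²) (∑-distribˡ-* Xs v (λ x → v * Q x - t * t)) ⟩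
          v * ∑ Xs (λ x → v * Q x - t * t)
            ≡⟨ cong (v *_) (trans (∑-distrib-- Xs (λ x → v * Q x) (λ _ → t * t))
                 (cong₂ _-_ (∑-distribˡ-* Xs v Q) (∑-const Xs (t * t)))) ⟩
          v * (v * ∑ Xs Q - ∣X∣ * (t * t))
            ≤⟨ *-monoˡ {v} 0≤+ (+-monoˡ-≤ (- (∣X∣ * (t * t))) Q≤) ⟩
          v * (∣X∣ * (t * t) + v * ∣X∣ * E - ∣X∣ * (t * t))
            ≡⟨ collect v ∣X∣ t E ⟩
          v * v * ∣X∣ * E ∎
          where
          open ≤-Reasoning
          t = ∑ Rs f
          E = ∑ Rs (λ r → f r * f r)
          Q : X → ℤ
          Q x = ∑ Rs (λ r → f r * mass x (φ r x))
          collect : ∀ v n t E → v * (n * (t * t) + v * n * E - n * (t * t)) ≡ v * v * n * E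
          collect = solve-∀
          regroup : ∀ a b i n v → a * (b * (n + i * (v * n))) ≡ n * a * b + v * n * a * (i * b)
          regroup = solve-∀
          per-pair : ∀ r r′ → v * ∑ Xs (λ x → f r * (𝟙 (φ r′ x ≟V φ r x) * f r′))
                            ≤ f r * (f r′ * (∣X∣ + 𝟙 (r ≟R r′) * (v * ∣X∣)))
          per-pair r r′ = begin
            v * ∑ Xs (λ x → f r * (𝟙 (φ r′ x ≟V φ r x) * f r′))
              ≡⟨ cong (v *_) (trans (∑-distribˡ-* Xs (f r) _) (cong (f r *_) (∑-distribʳ-* Xs (f r′) (λ x → 𝟙 (φ r′ x ≟V φ r x))))) ⟩
            v * (f r * (∑ Xs (λ x → 𝟙 (φ r′ x ≟V φ r x)) * f r′))
              ≡⟨ shuffle v (f r) (∑ Xs (λ x → 𝟙 (φ r′ x ≟V φ r x))) (f r′) ⟩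
            f r * (f r′ * (v * ∑ Xs (λ x → 𝟙 (φ r′ x ≟V φ r x))))
              ≤⟨ *-monoˡ (0≤f r) (*-monoˡ (0≤f r′) (collisions≤ r r′)) ⟩
            f r * (f r′ * (∣X∣ + 𝟙 (r ≟R r′) * (v * ∣X∣))) ∎
            where
            shuffle : ∀ v a c b → v * (a * (c * b)) ≡ a * (b * (v * c))
            shuffle = solve-∀
          Q≤ : v * ∑ Xs Q ≤ ∣X∣ * (t * t) + v * ∣X∣ * E
          Q≤ = begin
            v * ∑ Xs Q
              ≡⟨ cong (v *_) (∑-cong Xs λ x → ∑-cong Rs λ r → sym (∑-distribˡ-* Rs (f r) (λ r′ → 𝟙 (φ r′ x ≟V φ r x) * f r′))) ⟩
            v * ∑ Xs (λ x → ∑ Rs (λ r → ∑ Rs (λ r′ → c x r r′)))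
              ≡⟨ cong (v *_) (trans (∑-swap Xs Rs (λ x r → ∑ Rs (c x r))) (∑-cong Rs λ r → ∑-swap Xs Rs (λ x r′ → c x r r′))) ⟩
            v * ∑ Rs (λ r → ∑ Rs (λ r′ → ∑ Xs (λ x → c x r r′)))
              ≡⟨ sym (trans (∑-cong Rs λ r → ∑-distribˡ-* Rs v (λ r′ → ∑ Xs (λ x → c x r r′)))
                   (∑-distribˡ-* Rs v (λ r → ∑ Rs (λ r′ → ∑ Xs (λ x → c x r r′))))) ⟩
            ∑ Rs (λ r → ∑ Rs (λ r′ → v * ∑ Xs (λ x → c x r r′)))
              ≤⟨ ∑-mono Rs (λ r → ∑-mono Rs (λ r′ → per-pair r r′)) ⟩
            ∑ Rs (λ r → ∑ Rs (λ r′ → f r * (f r′ * (∣X∣ + 𝟙 (r ≟R r′) * (v * ∣X∣)))))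
              ≡⟨ ∑-cong Rs (λ r → inner r) ⟩
            ∑ Rs (λ r → ∣X∣ * f r * t + v * ∣X∣ * f r * f r)
              ≡⟨ ∑-distrib-+ Rs (λ r → ∣X∣ * f r * t) (λ r → v * ∣X∣ * f r * f r) ⟩
            ∑ Rs (λ r → ∣X∣ * f r * t) + ∑ Rs (λ r → v * ∣X∣ * f r * f r)
              ≡⟨ cong₂ _+_
                   (trans (∑-cong Rs λ r → *-assoc ∣X∣ (f r) t) (trans (∑-distribˡ-* Rs ∣X∣ (λ r → f r * t)) (cong (∣X∣ *_) (∑-distribʳ-* Rs t f))))
                   (trans (∑-cong Rs λ r → *-assoc (v * ∣X∣) (f r) (f r)) (∑-distribˡ-* Rs (v * ∣X∣) (λ r → f r * f r))) ⟩
            ∣X∣ * (t * t) + v * ∣X∣ * E ∎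
            where
            c : X → R → R → ℤ
            c x r r′ = f r * (𝟙 (φ r′ x ≟V φ r x) * f r′)
            inner : ∀ r → ∑ Rs (λ r′ → f r * (f r′ * (∣X∣ + 𝟙 (r ≟R r′) * (v * ∣X∣)))) ≡ ∣X∣ * f r * t + v * ∣X∣ * f r * f r
            inner r = trans (∑-cong Rs λ r′ → regroup (f r) (f r′) (𝟙 (r ≟R r′)) ∣X∣ v)
              (trans (∑-distrib-+ Rs (λ r′ → ∣X∣ * f r * f r′) (λ r′ → v * ∣X∣ * f r * (𝟙 (r ≟R r′) * f r′)))
                (cong₂ _+_ (∑-distribˡ-* Rs (∣X∣ * f r) f)
                  (trans (∑-distribˡ-* Rs (v * ∣X∣ * f r) (λ r′ → 𝟙 (r ≟R r′) * f r′)) (cong (v * ∣X∣ * f r *_) (Finite.∑-δ finR r f)))))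

    -- W / v ^ m is the value T would have if the hashes φ* w x were uniformly distributed.
    T : ∀ m → (Vec R m → ℤ) → (X → Vec V m → ℤ) → ℤ
    T m f g = ∑ Xs (λ x → ∑ (Rⁿ m) (λ w → f w * g x (φ* w x)))

    ‖_‖² : ∀ {m} → (Vec R m → ℤ) → ℤ
    ‖_‖² {m} f = ∑ (Rⁿ m) (λ w → f w * f w)

    ‖_‖ₓ² : ∀ {m} → (X → Vec V m → ℤ) → ℤ
    ‖_‖ₓ² {m} g = ∑ Xs (λ x → ∑ (Vⁿ m) (λ s → g x s * g x s))

    -- If the hash of the first row were uniform, `v * T (suc m) f g` would equal
    -- `T m (∂f f) (∂g g)`: averaging a row means summing it out on both sides.
    ∂f : ∀ {m} → (Vec R (suc m) → ℤ) → Vec R m → ℤ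
    ∂f f w = ∑ Rs (λ r → f (r ∷ w))

    ∂g : ∀ {m} → (X → Vec V (suc m) → ℤ) → X → Vec V m → ℤ
    ∂g g x s′ = ∑ Vs (λ s → g x (s ∷ s′))

    -- Replacing one row by its average

    module Step {m} (f : Vec R (suc m) → ℤ) (0≤f : ∀ w → 0ℤ ≤ f w) (g : X → Vec V (suc m) → ℤ) where
      Index : Set
      Index = X × Vec R m × V

      Is : List Index
      Is = cartesianProduct Xs (cartesianProduct (Rⁿ m) Vs)

      ∑-Is : ∀ (h : Index → ℤ) → ∑ Is h ≡ ∑ Xs (λ x → ∑ (Rⁿ m) (λ w → ∑ Vs (λ s → h (x , w , s))))
      ∑-Is h = trans (∑-cartesianProductWith _,_ Xs (cartesianProduct (Rⁿ m) Vs) h)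
        (∑-cong Xs λ x → ∑-cartesianProductWith _,_ (Rⁿ m) Vs (λ p → h (x , p)))

      row : Vec R m → R → ℤ
      row w r = f (r ∷ w)

      G H : Index → ℤ
      G (x , w , s) = g x (s ∷ φ* w x)
      H (x , w , s) = deviation (row w) x s

      -- For fixed `x` and remaining rows `w`, the error of averaging is the deviation of the first
      -- row's hash paired with `g`. This exposes the inner product to which Cauchy-Schwarz applies.
      difference≡ : v * T (suc m) f g - T m (∂f f) (∂g g) ≡ ∑ Is (λ i → H i * G i)
      difference≡ = begin
        v * T (suc m) f g - T m (∂f f) (∂g g)
          ≡⟨ cong (λ z → v * z - T m (∂f f) (∂g g)) (∑-cong Xs λ x → trans (∑-vec finR m (λ w → f w * g x (φ* w x)))
               (∑-swap Rs (Rⁿ m) (λ r w → f (r ∷ w) * g x (φ r x ∷ φ* w x)))) ⟩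
        v * ∑ Xs (λ x → ∑ (Rⁿ m) (λ w → ∑ Rs (λ r → row w r * g x (φ r x ∷ φ* w x)))) - T m (∂f f) (∂g g)
          ≡⟨ cong (_- T m (∂f f) (∂g g)) (sym (trans (∑-cong Xs λ x → ∑-distribˡ-* (Rⁿ m) v _) (∑-distribˡ-* Xs v _))) ⟩
        ∑ Xs (λ x → ∑ (Rⁿ m) (λ w → v * ∑ Rs (λ r → row w r * g x (φ r x ∷ φ* w x)))) - T m (∂f f) (∂g g)
          ≡⟨ sym (trans (∑-cong Xs λ x → ∑-distrib-- (Rⁿ m) _ _) (∑-distrib-- Xs _ _)) ⟩
        ∑ Xs (λ x → ∑ (Rⁿ m) (λ w → v * ∑ Rs (λ r → row w r * g x (φ r x ∷ φ* w x)) - ∂f f w * ∂g g x (φ* w x)))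
          ≡⟨ ∑-cong Xs (λ x → ∑-cong (Rⁿ m) (λ w → per x w)) ⟩
        ∑ Xs (λ x → ∑ (Rⁿ m) (λ w → ∑ Vs (λ s → H (x , w , s) * G (x , w , s))))
          ≡⟨ sym (∑-Is (λ i → H i * G i)) ⟩
        ∑ Is (λ i → H i * G i) ∎
        where
        open ≡-Reasoning
        expand : ∀ v a t h → (v * a - t) * h ≡ v * (a * h) - t * h
        expand = solve-∀
        per : ∀ x w → v * ∑ Rs (λ r → row w r * g x (φ r x ∷ φ* w x)) - ∂f f w * ∂g g x (φ* w x)
            ≡ ∑ Vs (λ s → H (x , w , s) * G (x , w , s))
        per x w = sym (begin
          ∑ Vs (λ s → deviation (row w) x s * h s)
            ≡⟨ ∑-cong Vs (λ s → expand v (mass (row w) x s) (∂f f w) (h s)) ⟩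
          ∑ Vs (λ s → v * (mass (row w) x s * h s) - ∂f f w * h s)
            ≡⟨ ∑-distrib-- Vs (λ s → v * (mass (row w) x s * h s)) (λ s → ∂f f w * h s) ⟩
          ∑ Vs (λ s → v * (mass (row w) x s * h s)) - ∑ Vs (λ s → ∂f f w * h s)
            ≡⟨ cong₂ _-_ (trans (∑-distribˡ-* Vs v (λ s → mass (row w) x s * h s)) (cong (v *_) (∑-mass (row w) x h)))
                 (∑-distribˡ-* Vs (∂f f w) h) ⟩
          v * ∑ Rs (λ r → row w r * h (φ r x)) - ∂f f w * ∑ Vs h ∎)
          where
          h : V → ℤ
          h s = g x (s ∷ φ* w x)

      ∑H²≤ : ∑ Is (λ i → H i * H i) ≤ v * v * ∣X∣ * ‖ f ‖²
      ∑H²≤ = begin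
        ∑ Is (λ i → H i * H i)
          ≡⟨ trans (∑-Is (λ i → H i * H i)) (∑-swap Xs (Rⁿ m) (λ x w → ∑ Vs (λ s → H (x , w , s) * H (x , w , s)))) ⟩
        ∑ (Rⁿ m) (λ w → ∑ Xs (λ x → ∑ Vs (λ s → deviation (row w) x s * deviation (row w) x s)))
          ≤⟨ ∑-mono (Rⁿ m) (λ w → variance≤ (row w) (λ r → 0≤f (r ∷ w))) ⟩
        ∑ (Rⁿ m) (λ w → v * v * ∣X∣ * ∑ Rs (λ r → f (r ∷ w) * f (r ∷ w)))
          ≡⟨ ∑-distribˡ-* (Rⁿ m) (v * v * ∣X∣) _ ⟩
        v * v * ∣X∣ * ∑ (Rⁿ m) (λ w → ∑ Rs (λ r → f (r ∷ w) * f (r ∷ w)))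
          ≡⟨ cong (v * v * ∣X∣ *_) (trans (∑-swap (Rⁿ m) Rs (λ w r → f (r ∷ w) * f (r ∷ w))) (sym (∑-vec finR m (λ w → f w * f w)))) ⟩
        v * v * ∣X∣ * ‖ f ‖² ∎
        where open ≤-Reasoning

      -- Only the `m` remaining rows are hashed here; the first one already runs freely over V.
      -- Hence `k ^ m`, not `k ^ suc m`, and this missing factor is the gain of the whole method.
      ∑G²≤ : ∑ Is (λ i → G i * G i) ≤ k ^ m * ‖ g ‖ₓ²
      ∑G²≤ = begin
        ∑ Is (λ i → G i * G i)
          ≡⟨ ∑-Is (λ i → G i * G i) ⟩
        ∑ Xs (λ x → ∑ (Rⁿ m) (λ w → h x (φ* w x)))
          ≤⟨ ∑-mono Xs (λ x → ∑-fibre*≤ m x (h x) (λ s′ → ∑-nonNeg Vs (λ s → 0≤sq (g x (s ∷ s′))))) ⟩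
        ∑ Xs (λ x → k ^ m * ∑ (Vⁿ m) (h x))
          ≡⟨ ∑-distribˡ-* Xs (k ^ m) (λ x → ∑ (Vⁿ m) (h x)) ⟩
        k ^ m * ∑ Xs (λ x → ∑ (Vⁿ m) (h x))
          ≡⟨ cong (k ^ m *_) (∑-cong Xs λ x → trans (∑-swap (Vⁿ m) Vs (λ s′ s → g x (s ∷ s′) * g x (s ∷ s′)))
               (sym (∑-vec finV m (λ s → g x s * g x s)))) ⟩
        k ^ m * ‖ g ‖ₓ² ∎
        where
        open ≤-Reasoning
        h : X → Vec V m → ℤ
        h x s′ = ∑ Vs (λ s → g x (s ∷ s′) * g x (s ∷ s′))

      D : ℤ
      D = v * T (suc m) f g - T m (∂f f) (∂g g)

      difference²≤ : D * D ≤ v * v * ∣X∣ * ‖ f ‖² * (k ^ m * ‖ g ‖ₓ²)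
      difference²≤ = ≤-trans (subst (λ z → z * z ≤ ∑ Is (λ i → H i * H i) * ∑ Is (λ i → G i * G i)) (sym difference≡) (cauchy-schwarz Is H G))
        (*-mono (∑-nonNeg Is λ i → 0≤sq (H i))
                (*-nonNeg (0≤^ m 0≤k) (∑-nonNeg Xs λ x → ∑-nonNeg (Vⁿ (suc m)) λ s → 0≤sq (g x s)))
                ∑H²≤ ∑G²≤)

    -- Cauchy-Schwarz against the constant one, for each `w`.
    ‖∂f‖²≤ : ∀ {m} (f : Vec R (suc m) → ℤ) → ‖ ∂f f ‖² ≤ ∣R∣ * ‖ f ‖²
    ‖∂f‖²≤ {m} f = ≤-trans (∑-mono (Rⁿ m) λ w → ∑-square≤ Rs (λ r → f (r ∷ w)))
      (≤-reflexive (trans (∑-distribˡ-* (Rⁿ m) ∣R∣ _) (cong (∣R∣ *_)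
        (trans (∑-swap (Rⁿ m) Rs (λ w r → f (r ∷ w) * f (r ∷ w))) (sym (∑-vec finR m (λ w → f w * f w)))))))

    ‖∂g‖²≤ : ∀ {m} (g : X → Vec V (suc m) → ℤ) → ‖ ∂g g ‖ₓ² ≤ v * ‖ g ‖ₓ²
    ‖∂g‖²≤ {m} g = ≤-trans (∑-mono Xs λ x → ∑-mono (Vⁿ m) λ s′ → ∑-square≤ Vs (λ s → g x (s ∷ s′)))
      (≤-reflexive (trans (∑-cong Xs λ x → ∑-distribˡ-* (Vⁿ m) v _) (trans (∑-distribˡ-* Xs v _)
        (cong (v *_) (∑-cong Xs λ x →
          trans (∑-swap (Vⁿ m) Vs (λ s′ s → g x (s ∷ s′) * g x (s ∷ s′))) (sym (∑-vec finV m (λ s → g x s * g x s))))))))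

    -- Discrepancy by induction on the rows

    W : ∀ m → (Vec R m → ℤ) → (X → Vec V m → ℤ) → ℤ
    W m f g = ∑ (Rⁿ m) f * ∑ Xs (λ x → ∑ (Vⁿ m) (g x))

    -- Summing out a coordinate keeps total mass, so all stages of the averaging share the same main
    -- term and the errors telescope.
    W-∂ : ∀ {m} (f : Vec R (suc m) → ℤ) (g : X → Vec V (suc m) → ℤ) → W (suc m) f g ≡ W m (∂f f) (∂g g)
    W-∂ {m} f g = cong₂ _*_ (trans (∑-vec finR m f) (∑-swap Rs (Rⁿ m) (λ r w → f (r ∷ w))))
      (∑-cong Xs λ x → trans (∑-vec finV m (g x)) (∑-swap Vs (Vⁿ m) (λ s s′ → g x (s ∷ s′))))

    discrepancy : ∀ m → (Vec R m → ℤ) → (X → Vec V m → ℤ) → ℤ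
    discrepancy m f g = v ^ m * T m f g - W m f g

    -- Each row brings a factor `v * v * k`. In the error of averaging, `v * v` comes from scaling
    -- and `k` from the fibres; in the norms, `∂f` brings `∣R∣`, at most `k * v`, and `∂g` brings
    -- `v`.
    bound : ℕ → ℤ
    bound m = (v * v * k) ^ m * ∣X∣

    private
      0≤vvk : 0ℤ ≤ v * v * k
      0≤vvk = *-nonNeg (*-nonNeg {v} {v} 0≤+ 0≤+) 0≤k

      sq-+≤ : ∀ a b → (a + b) * (a + b) ≤ + 2 * (a * a) + + 2 * (b * b)
      sq-+≤ a b = 0≤i-j⇒j≤i (subst (0ℤ ≤_) (sym (eq a b)) (0≤sq (a - b)))
        where
        eq : ∀ a b → + 2 * (a * a) + + 2 * (b * b) - (a + b) * (a + b) ≡ (a - b) * (a - b)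
        eq = solve-∀

      v²ᵐ : ∀ m → v ^ m * v ^ m * k ^ m ≡ (v * v * k) ^ m
      v²ᵐ zero    = refl
      v²ᵐ (suc m) = trans (lemma v (v ^ m) k (k ^ m)) (cong (v * v * k *_) (v²ᵐ m))
        where
        lemma : ∀ v V k K → v * V * (v * V) * (k * K) ≡ v * v * k * (V * V * K)
        lemma = solve-∀

    -- The `k` on the left records the saving: the row being averaged is estimated by its variance
    -- and pays no fibre factor. The recursion for `κ` adds the new error to the errors of the
    -- remaining rows.
    discrepancy²≤ : ∀ m f → (∀ w → 0ℤ ≤ f w) → ∀ g →
      k * (discrepancy m f g * discrepancy m f g) ≤ κ m * (bound m * (‖ f ‖² * ‖ g ‖ₓ²))
    -- With no rows left nothing is random, and `T` and `W` agree exactly.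
    discrepancy²≤ zero    f 0≤f g = ≤-reflexive (trans (cong (λ z → k * (z * z)) zero-discrepancy) (trans (*-zeroʳ k) (sym (*-zeroˡ (bound 0 * (‖ f ‖² * ‖ g ‖ₓ²))))))
      where
      open ≡-Reasoning
      zero-discrepancy : discrepancy 0 f g ≡ 0ℤ
      zero-discrepancy = begin
        1ℤ * T 0 f g - W 0 f g
          ≡⟨ cong₂ _-_ (*-identityˡ (T 0 f g)) (cong₂ _*_ (+-identityʳ (f [])) (∑-cong Xs λ x → +-identityʳ (g x []))) ⟩
        ∑ Xs (λ x → f [] * g x [] + 0ℤ) - f [] * ∑ Xs (λ x → g x [])
          ≡⟨ cong (_- f [] * ∑ Xs (λ x → g x [])) (trans (∑-cong Xs λ x → +-identityʳ (f [] * g x [])) (∑-distribˡ-* Xs (f []) (λ x → g x []))) ⟩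
        f [] * ∑ Xs (λ x → g x []) - f [] * ∑ Xs (λ x → g x [])
          ≡⟨ +-inverseʳ (f [] * ∑ Xs (λ x → g x [])) ⟩
        0ℤ ∎
    discrepancy²≤ (suc m) f 0≤f g = begin
      k * (discrepancy (suc m) f g * discrepancy (suc m) f g)
        ≡⟨ cong (λ z → k * (z * z)) split ⟩
      k * ((v ^ m * D + e) * (v ^ m * D + e))
        ≤⟨ *-monoˡ 0≤k (sq-+≤ (v ^ m * D) e) ⟩
      k * (+ 2 * (v ^ m * D * (v ^ m * D)) + + 2 * (e * e))
        ≡⟨ regroup k (v ^ m) D e ⟩
      + 2 * (k * (v ^ m * v ^ m) * (D * D) + k * (e * e))
        ≤⟨ *-monoˡ {+ 2} 0≤+ (+-mono-≤ first second) ⟩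
      + 2 * (Z + κ m * Z)
        ≡⟨ factor (κ m) Z ⟩
      κ (suc m) * Z ∎
      where
      open ≤-Reasoning
      open Step f 0≤f g using (D; difference²≤)
      e = discrepancy m (∂f f) (∂g g)
      Z = bound (suc m) * (‖ f ‖² * ‖ g ‖ₓ²)
      0≤‖f‖² : 0ℤ ≤ ‖ f ‖²
      0≤‖f‖² = ∑-nonNeg (Rⁿ (suc m)) λ w → 0≤sq (f w)
      0≤‖g‖² : 0ℤ ≤ ‖ g ‖ₓ²
      0≤‖g‖² = ∑-nonNeg Xs λ x → ∑-nonNeg (Vⁿ (suc m)) λ s → 0≤sq (g x s)
      telescope : ∀ v V T T′ W → v * V * T - W ≡ V * (v * T - T′) + (V * T′ - W)
      telescope = solve-∀
      split : discrepancy (suc m) f g ≡ v ^ m * D + e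
      split = trans (cong (λ z → v ^ suc m * T (suc m) f g - z) (W-∂ f g))
        (telescope v (v ^ m) (T (suc m) f g) (T m (∂f f) (∂g g)) (W m (∂f f) (∂g g)))
      regroup : ∀ k V D e → k * (+ 2 * (V * D * (V * D)) + + 2 * (e * e)) ≡ + 2 * (k * (V * V) * (D * D) + k * (e * e))
      regroup = solve-∀
      factor : ∀ κ Z → + 2 * (Z + κ * Z) ≡ + 2 * (1ℤ + κ) * Z
      factor = solve-∀
      collect : ∀ k VV v n a K b → k * VV * (v * v * n * a * (K * b)) ≡ v * v * k * (VV * K) * n * (a * b)
      collect = solve-∀
      -- The outer `k` supplies the one fibre factor that `difference²≤` lacks compared with
      -- `bound (suc m)`.
      first : k * (v ^ m * v ^ m) * (D * D) ≤ Z
      first = begin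
        k * (v ^ m * v ^ m) * (D * D)
          ≤⟨ *-monoˡ (*-nonNeg 0≤k (0≤sq (v ^ m))) difference²≤ ⟩
        k * (v ^ m * v ^ m) * (v * v * ∣X∣ * ‖ f ‖² * (k ^ m * ‖ g ‖ₓ²))
          ≡⟨ collect k (v ^ m * v ^ m) v ∣X∣ ‖ f ‖² (k ^ m) ‖ g ‖ₓ² ⟩
        v * v * k * (v ^ m * v ^ m * k ^ m) * ∣X∣ * (‖ f ‖² * ‖ g ‖ₓ²)
          ≡⟨ cong (λ z → v * v * k * z * ∣X∣ * (‖ f ‖² * ‖ g ‖ₓ²)) (v²ᵐ m) ⟩
        Z ∎
      0≤bound : 0ℤ ≤ bound m
      0≤bound = *-nonNeg (0≤^ m 0≤vvk) 0≤+
      collect′ : ∀ B n k v a b → B * n * (k * v * a * (v * b)) ≡ v * v * k * B * n * (a * b)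
      collect′ = solve-∀
      -- Norm growth under `∂f` and `∂g` amounts to `k * v * v`, exactly the step from `bound m` to
      -- `bound (suc m)`.
      second : k * (e * e) ≤ κ m * Z
      second = begin
        k * (e * e)
          ≤⟨ discrepancy²≤ m (∂f f) (λ w → ∑-nonNeg Rs λ r → 0≤f (r ∷ w)) (∂g g) ⟩
        κ m * (bound m * (‖ ∂f f ‖² * ‖ ∂g g ‖ₓ²))
          ≤⟨ *-monoˡ (0≤κ m) (*-monoˡ 0≤bound (*-mono
               (∑-nonNeg (Rⁿ m) λ w → 0≤sq (∂f f w)) (*-nonNeg {v} 0≤+ 0≤‖g‖²)
               (≤-trans (‖∂f‖²≤ f) (*-monoʳ 0≤‖f‖² ∣R∣≤)) (‖∂g‖²≤ g))) ⟩
        κ m * (bound m * (k * v * ‖ f ‖² * (v * ‖ g ‖ₓ²)))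
          ≡⟨ cong (κ m *_) (collect′ ((v * v * k) ^ m) ∣X∣ k v ‖ f ‖² ‖ g ‖ₓ²) ⟩
        κ m * Z ∎

-- Coding field elements, rows and matrices; the affine row maps

module Coding where
  open import Data.Nat using (ℕ; zero; suc)
  open import Data.Fin using (Fin; zero; suc)
  open import Data.Fin.Properties using (all?)
  open import Data.List as List using (List; []; _∷_)
  open import Data.List.Relation.Unary.All as All using (All)
  open import Data.List.Relation.Unary.Any using (index)
  open import Data.List.Relation.Unary.Any.Properties using (lookup-index)
  open import Data.List.Relation.Unary.AllPairs using (AllPairs; _∷_)
  open import Data.List.Membership.Propositional.Properties using (∈-lookup)
  open import Data.Vec using (Vec; []; _∷_; lookup; tabulate; map; zip)
  open import Data.Vec.Properties using (lookup∘tabulate; tabulate∘lookup; tabulate-cong; lookup-map; lookup-zip)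
  open import Data.Product using (_×_; _,_)
  open import Relation.Nullary using (¬_; Dec)
  open import Data.Empty using (⊥-elim)
  open import Relation.Binary.PropositionalEquality as ≡ using (_≡_)

  lookup-ext : ∀ {A : Set} {m} {xs ys : Vec A m} → (∀ i → lookup xs i ≡ lookup ys i) → xs ≡ ys
  lookup-ext {xs = xs} {ys} eq = ≡.trans (≡.sym (tabulate∘lookup xs)) (≡.trans (tabulate-cong eq) (tabulate∘lookup ys))

  module FieldAlgebra (F : FiniteField) (n : ℕ) where
    open FiniteField F hiding (zero)
    open Matrices F n
    open import Algebra.Properties.AbelianGroup +-abelianGroup using (∙-cancelˡ; ∙-cancelʳ)
    open import Algebra.Properties.CommutativeSemigroup +-commutativeSemigroup using (interchange)
    open import Relation.Binary.Reasoning.Setoid setoid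

    -- Field elements are coded by their positions in the enumeration, so that the equalities _≈_ and
    -- _≈M_ become propositional equality of codes.
    decode : Fin order → Carrier
    decode = List.lookup elements

    encode : Carrier → Fin order
    encode x = index (complete x)

    decode-encode : ∀ x → decode (encode x) ≈ x
    decode-encode x = sym (lookup-index (complete x))

    decode-injective : ∀ {i j} → decode i ≈ decode j → i ≡ j
    decode-injective = go distinct
      where
      go : ∀ {xs} → AllPairs (λ x y → ¬ (x ≈ y)) xs → ∀ {i j} → List.lookup xs i ≈ List.lookup xs j → i ≡ j
      go (x≉ ∷ u) {zero}  {zero}  eq = ≡.refl
      go (x≉ ∷ u) {zero}  {suc j} eq = ⊥-elim (All.lookup x≉ (∈-lookup j) eq)
      go (x≉ ∷ u) {suc i} {zero}  eq = ⊥-elim (All.lookup x≉ (∈-lookup i) (sym eq))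
      go (x≉ ∷ u) {suc i} {suc j} eq = ≡.cong suc (go u eq)

    encode-cong : ∀ {x y} → x ≈ y → encode x ≡ encode y
    encode-cong {x} {y} x≈y = decode-injective (trans (decode-encode x) (trans x≈y (sym (decode-encode y))))

    sumFin-cong : ∀ {m} {f g : Fin m → Carrier} → (∀ k → f k ≈ g k) → sumFin f ≈ sumFin g
    sumFin-cong {zero}  f≈g = refl
    sumFin-cong {suc m} f≈g = +-cong (f≈g zero) (sumFin-cong (λ k → f≈g (suc k)))

    sumFin-+ : ∀ {m} (f g : Fin m → Carrier) → sumFin (λ k → f k + g k) ≈ sumFin f + sumFin g
    sumFin-+ {zero}  f g = sym (+-identityˡ 0#)
    sumFin-+ {suc m} f g = trans (+-congˡ (sumFin-+ (λ k → f (suc k)) (λ k → g (suc k)))) (interchange _ _ _ _)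

    sumFin-* : ∀ {m} c (f : Fin m → Carrier) → sumFin (λ k → c * f k) ≈ c * sumFin f
    sumFin-* {zero}  c f = sym (zeroʳ c)
    sumFin-* {suc m} c f = trans (+-congˡ (sumFin-* c (λ k → f (suc k)))) (sym (distribˡ c _ _))

    *-cancelˡ : ∀ {a x y} → ¬ (a ≈ 0#) → a * x ≈ a * y → x ≈ y
    *-cancelˡ {a} {x} {y} a≉0 ax≈ay with inverse a a≉0
    ... | b , ab≈1 = trans (sym (undo x)) (trans (*-congˡ ax≈ay) (undo y))
      where
      undo : ∀ z → b * (a * z) ≈ z
      undo z = trans (sym (*-assoc b a z)) (trans (*-congʳ (trans (*-comm b a) ab≈1)) (*-identityˡ z))

    difference+ : ∀ a b → (a - b) + b ≈ a
    difference+ a b = trans (+-assoc a (- b) b) (trans (+-congˡ (-‿inverseˡ b)) (+-identityʳ a))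

    difference≈0 : ∀ {a b} → a - b ≈ 0# → a ≈ b
    difference≈0 {a} {b} eq = trans (sym (difference+ a b)) (trans (+-congʳ eq) (+-identityˡ b))

    -- Row vector times matrix. The number of rows is left free although the matrices are square,
    -- because solutions are counted by stripping rows.
    lin : ∀ {m} → (Fin m → Carrier) → (Fin m → Fin n → Carrier) → Fin n → Carrier
    lin u x j = sumFin (λ k → u k * x k j)

    lin-cong : ∀ {m} {u u′ : Fin m → Carrier} {x x′ : Fin m → Fin n → Carrier} →
      (∀ k → u k ≈ u′ k) → (∀ k j → x k j ≈ x′ k j) → ∀ j → lin u x j ≈ lin u′ x′ j
    lin-cong u≈ x≈ j = sumFin-cong (λ k → *-cong (u≈ k) (x≈ k j))

    lin-+ : ∀ {m} (u u′ : Fin m → Carrier) x j → lin (λ k → u k + u′ k) x j ≈ lin u x j + lin u′ x j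
    lin-+ u u′ x j = trans (sumFin-cong (λ k → distribʳ (x k j) (u k) (u′ k))) (sumFin-+ (λ k → u k * x k j) (λ k → u′ k * x k j))

    lin-* : ∀ {m} c (u : Fin m → Carrier) x j → lin (λ k → c * u k) x j ≈ c * lin u x j
    lin-* c u x j = trans (sumFin-cong (λ k → *-assoc c (u k) (x k j))) (sumFin-* c (λ k → u k * x k j))

    lin-0 : ∀ {m} (x : Fin m → Fin n → Carrier) j → lin (λ _ → 0#) x j ≈ 0#
    lin-0 x j = trans (sumFin-* 0# (λ k → x k j)) (zeroˡ _)

    lin-difference : ∀ {m} (u u′ : Fin m → Carrier) x j → lin (λ k → u k - u′ k) x j + lin u′ x j ≈ lin u x j
    lin-difference u u′ x j = trans (sym (lin-+ _ u′ x j)) (lin-cong {x = x} (λ k → difference+ (u k) (u′ k)) (λ _ _ → refl) j)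

    V : Set
    V = Vec (Fin order) n

    val : V → Fin n → Carrier
    val v j = decode (lookup v j)

    code : (Fin n → Carrier) → V
    code f = tabulate (λ j → encode (f j))

    val-code : ∀ f j → val (code f) j ≈ f j
    val-code f j = trans (reflexive (≡.cong decode (lookup∘tabulate _ j))) (decode-encode (f j))

    code-cong : ∀ {f g} → (∀ j → f j ≈ g j) → code f ≡ code g
    code-cong f≈g = tabulate-cong (λ j → encode-cong (f≈g j))

    code-injective : ∀ {f g} → code f ≡ code g → ∀ j → f j ≈ g j
    code-injective {f} {g} eq j = trans (sym (val-code f j)) (trans (reflexive (≡.cong (λ v → val v j) eq)) (val-code g j))

    val-injective : ∀ {u v} → (∀ j → val u j ≈ val v j) → u ≡ v
    val-injective eq = lookup-ext (λ j → decode-injective (eq j))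

    vals : ∀ {m} → Vec V m → Fin m → Fin n → Carrier
    vals x k = val (lookup x k)

    codeM : Mat → Vec V n
    codeM X = tabulate (λ i → code (X i))

    lookup-codeM : ∀ X i → lookup (codeM X) i ≡ code (X i)
    lookup-codeM X i = lookup∘tabulate _ i

    codeM-cong : ∀ {X Y} → X ≈M Y → codeM X ≡ codeM Y
    codeM-cong X≈Y = tabulate-cong (λ i → code-cong (X≈Y i))

    vals-codeM : ∀ X i j → vals (codeM X) i j ≈ X i j
    vals-codeM X i j = trans (reflexive (≡.cong (λ v → val v j) (lookup-codeM X i))) (val-code (X i) j)

    codeM-injective : ∀ {X Y} → codeM X ≡ codeM Y → X ≈M Y
    codeM-injective {X} {Y} eq i j =
      trans (sym (vals-codeM X i j)) (trans (reflexive (≡.cong (λ x → vals x i j) eq)) (vals-codeM Y i j))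

    φ : V × V → Vec V n → V
    φ (c , p) x = code (λ j → lin (val c) (vals x) j + val p j)

    -- Row i of C B + P involves only the rows i of C and P, so one matrix equation is n hash
    -- equations sharing the argument B.
    φ-matrix : ∀ C P B → map (λ r → φ r (codeM B)) (zip (codeM C) (codeM P)) ≡ codeM ((C *M B) +M P)
    φ-matrix C P B = lookup-ext λ i → ≡.trans (lookup-map i _ (zip (codeM C) (codeM P)))
      (≡.trans (≡.cong (λ r → φ r (codeM B)) (lookup-zip i (codeM C) (codeM P)))
      (≡.trans (code-cong (λ j → +-cong
         (lin-cong {u = vals (codeM C) i} {x = vals (codeM B)} (vals-codeM C i) (vals-codeM B) j)
         (vals-codeM P i j)))
      (≡.sym (lookup-codeM ((C *M B) +M P) i))))

    φ-injectiveʳ : ∀ {c p p′} x → φ (c , p) x ≡ φ (c , p′) x → p ≡ p′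
    φ-injectiveʳ x eq = val-injective λ j → ∙-cancelˡ _ _ _ (code-injective eq j)

    φ-collision : ∀ {c p c′ p′} x → φ (c , p) x ≡ φ (c′ , p′) x →
      ∀ j → lin (λ k → val c k - val c′ k) (vals x) j ≈ val p′ j - val p j
    φ-collision {c} {p} {c′} {p′} x eq j = ∙-cancelʳ (val p j) _ _ (∙-cancelˡ (lin (val c′) (vals x) j) _ _ (begin
      L′ + (D + val p j)                 ≈⟨ sym (+-assoc L′ D (val p j)) ⟩
      (L′ + D) + val p j                 ≈⟨ +-congʳ (trans (+-comm L′ D) (lin-difference (val c) (val c′) (vals x) j)) ⟩
      lin (val c) (vals x) j + val p j   ≈⟨ code-injective eq j ⟩
      L′ + val p′ j                      ≈⟨ +-congˡ (sym (difference+ (val p′ j) (val p j))) ⟩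
      L′ + (val p′ j - val p j + val p j) ∎))
      where
      D  = lin (λ k → val c k - val c′ k) (vals x) j
      L′ = lin (val c′) (vals x) j

    Solves : ∀ {m} → (Fin m → Carrier) → (Fin n → Carrier) → Vec V m → Set
    Solves u d x = ∀ j → lin u (vals x) j ≈ d j

    solves? : ∀ {m} (u : Fin m → Carrier) d x → Dec (Solves u d x)
    solves? u d x = all? λ j → lin u (vals x) j ≟ d j

    solves-unique : ∀ {m} {u : Fin (suc m) → Carrier} {d y z x} → ¬ (u zero ≈ 0#) →
      Solves u d (y ∷ x) → Solves u d (z ∷ x) → y ≡ z
    solves-unique u₀≉0 s t = val-injective λ j → *-cancelˡ u₀≉0 (∙-cancelʳ _ _ _ (trans (s j) (sym (t j))))

    solves-tail : ∀ {m} {u : Fin (suc m) → Carrier} {d y x} → u zero ≈ 0# →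
      Solves u d (y ∷ x) → Solves (λ k → u (suc k)) d x
    solves-tail {u = u} {y = y} u₀≈0 s j =
      trans (sym (trans (+-congʳ (trans (*-congʳ u₀≈0) (zeroˡ (val y j)))) (+-identityˡ _))) (s j)

    0V : V
    0V = code (λ _ → 0#)

    -- Phrased as a collision of the hashes (v, 0) and (0, 0), so that universality also bounds the
    -- average kernel size.
    InKernel : Vec V n → V → Set
    InKernel x v = φ (v , 0V) x ≡ φ (0V , 0V) x

    inKernel : ∀ {X u} → (∀ j → lin u X j ≈ 0#) → InKernel (codeM X) (code u)
    inKernel {X} {u} uX≈0 = code-cong λ j → +-congʳ (begin
      lin (val (code u)) (vals (codeM X)) j ≈⟨ lin-cong (val-code u) (vals-codeM X) j ⟩
      lin u X j                             ≈⟨ uX≈0 j ⟩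
      0#                                    ≈⟨ sym (lin-0 (vals (codeM X)) j) ⟩
      lin (λ _ → 0#) (vals (codeM X)) j     ≈⟨ lin-cong {x = vals (codeM X)} (λ k → sym (val-code (λ _ → 0#) k)) (λ _ _ → refl) j ⟩
      lin (val 0V) (vals (codeM X)) j       ∎)

    scale : (Fin n → Carrier) → Fin order → V
    scale u t = code (λ k → decode t * u k)

    scale-injective : ∀ {u k} → ¬ (u k ≈ 0#) → ∀ {s t} → scale u s ≡ scale u t → s ≡ t
    scale-injective {u} {k} uk≉0 {s} {t} eq = decode-injective (*-cancelˡ uk≉0
      (trans (*-comm (u k) (decode s)) (trans (code-injective eq k) (*-comm (decode t) (u k)))))

    inKernel-scale : ∀ {X u} → (∀ j → lin u X j ≈ 0#) → ∀ t → InKernel (codeM X) (scale u t)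
    inKernel-scale {X} {u} uX≈0 t = inKernel {X} λ j →
      trans (lin-* (decode t) u X j) (trans (*-congˡ (uX≈0 j)) (zeroʳ (decode t)))

    -- Trivial left kernel, since matrices act here on row vectors from the right.
    Regular : Mat → Set
    Regular X = ∀ u → (∀ j → lin u X j ≈ 0#) → ∀ k → u k ≈ 0#

    -- Every row of S - T lies in the left kernel of X.
    regular-cancel : ∀ {X S T} → Regular X → (S *M X) ≈M (T *M X) → S ≈M T
    regular-cancel {X} {S} {T} reg eq i k = difference≈0 (reg (λ k → S i k - T i k)
      (λ j → ∙-cancelʳ (lin (T i) X j) _ _ (trans (lin-difference (S i) (T i) X j) (trans (eq i j) (sym (+-identityˡ _))))) k)

    sum-product : ∀ A B C → ((C *M B) +M (A *M B)) ≈M ((A +M C) *M B)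
    sum-product A B C i j = trans (+-comm _ _) (sym (lin-+ (A i) (C i) B j))

    +M-cancelʳ : ∀ {A B} C → (A +M C) ≈M (B +M C) → A ≈M B
    +M-cancelʳ C eq i j = ∙-cancelʳ (C i j) _ _ (eq i j)

    order≢0 : ¬ (order ≡ 0)
    order≢0 eq with encode 0#
    ... | i rewrite eq with i
    ... | ()

-- Universality of the affine maps and the rarity of singular matrices

module Counting where
  open Sums
  open Hashing
  open Coding
  open import Data.Integer using (ℤ; +_; 1ℤ; _+_; _*_; _≤_; Positive)
  open import Data.Integer.Properties hiding (_≟_)
  open import Data.Integer.Tactic.RingSolver using (solve-∀)
  open import Data.Nat as ℕ using (ℕ; zero; suc)
  open import Data.Nat.Properties using (m^n≢0)
  open import Data.Fin using (Fin; zero; suc)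
  open import Data.Fin.Properties using (¬∀⟶∃¬)
  open import Data.List using (allFin; map; length)
  open import Data.List.Properties using (length-tabulate)
  open import Data.List.Relation.Unary.Unique.Propositional.Properties using (map⁺; allFin⁺)
  open import Data.Product using (∃; _×_; _,_)
  open import Data.Vec using (Vec; _∷_)
  open import Data.Empty using (⊥-elim)
  open import Function using (id; _∘_)
  open import Relation.Nullary using (¬_; Dec; yes; no)
  open import Relation.Binary.PropositionalEquality

  module FieldCounting (F : FiniteField) (n : ℕ) where
    open FiniteField F using (Carrier; 0#; order) renaming (_≈_ to _≈F_; _≟_ to _≟F_; _-_ to _-F_)
    open Matrices F n using (Mat)
    open FieldAlgebra F n

    finV : Finite V
    finV = vecFinite (finFinite order) n

    finVec : ∀ m → Finite (Vec V m)
    finVec = vecFinite finV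

    finX : Finite (Vec V n)
    finX = finVec n

    finR : Finite (V × V)
    finR = productFinite finV finV

    open Finite finV using () renaming (enum to Vs; ∣∣ to v; _≟_ to _≟V_)
    open Finite finX using () renaming (enum to Xs; ∣∣ to ∣X∣)
    open Finite finR using () renaming (enum to Rs; ∣∣ to ∣R∣)

    ∣vec∣≡^ : ∀ {A : Set} (a : Finite A) {s} → Finite.∣∣ a ≡ + s → ∀ m → Finite.∣∣ (vecFinite a m) ≡ + (s ℕ.^ m)
    ∣vec∣≡^ a     eq zero    = refl
    ∣vec∣≡^ a {s} eq (suc m) = trans (∣vec∣ a m) (trans (cong₂ _*_ eq (∣vec∣≡^ a eq m)) (sym (pos-* s (s ℕ.^ m))))

    v≡ : v ≡ + (order ℕ.^ n)
    v≡ = ∣vec∣≡^ (finFinite order) (cong +_ (length-tabulate {n = order} id)) n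

    ∣X∣≡ : ∣X∣ ≡ + ((order ℕ.^ n) ℕ.^ n)
    ∣X∣≡ = ∣vec∣≡^ finV v≡ n

    -- Rows of x with vanishing coefficient are free and can be stripped; at the first nonzero
    -- coefficient, that row is determined by the later ones, which loses a factor `v`.
    solutions≤ : ∀ m (u : Fin m → Carrier) d → ∃ (λ k → ¬ (u k ≈F 0#)) →
      v * ∑ (Finite.enum (finVec m)) (λ x → 𝟙 (solves? u d x)) ≤ Finite.∣∣ (finVec m)
    solutions≤ (suc m) u d (k , uk≉0) with u zero ≟F 0#
    ... | no u₀≉0 = begin
      v * ∑ (Finite.enum (finVec (suc m))) (λ x → 𝟙 (solves? u d x))
        ≡⟨ cong (v *_) (trans (∑-vec finV m (λ x → 𝟙 (solves? u d x))) (∑-swap Vs (Finite.enum (finVec m)) (λ y x → 𝟙 (solves? u d (y ∷ x))))) ⟩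
      v * ∑ (Finite.enum (finVec m)) (λ x → ∑ Vs (λ y → 𝟙 (solves? u d (y ∷ x))))
        ≤⟨ *-monoˡ {v} 0≤+ (∑-mono (Finite.enum (finVec m)) λ x →
             Finite.∑-𝟙-unique≤1 finV (λ y → solves? u d (y ∷ x)) (λ {y} {z} → solves-unique {u = u} {d} {y} {z} {x} u₀≉0)) ⟩
      v * ∑ (Finite.enum (finVec m)) (λ _ → 1ℤ)
        ≡⟨ cong (v *_) (∑-1 (Finite.enum (finVec m))) ⟩
      v * Finite.∣∣ (finVec m)
        ≡⟨ sym (∣vec∣ finV m) ⟩
      Finite.∣∣ (finVec (suc m)) ∎
      where open ≤-Reasoning
    solutions≤ (suc m) u d (zero , u₀≉0)  | yes u₀≈0 = ⊥-elim (u₀≉0 u₀≈0)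
    solutions≤ (suc m) u d (suc k , uk≉0) | yes u₀≈0 = begin
      v * ∑ (Finite.enum (finVec (suc m))) (λ x → 𝟙 (solves? u d x))
        ≡⟨ cong (v *_) (∑-vec finV m (λ x → 𝟙 (solves? u d x))) ⟩
      v * ∑ Vs (λ y → ∑ (Finite.enum (finVec m)) (λ x → 𝟙 (solves? u d (y ∷ x))))
        ≤⟨ *-monoˡ {v} 0≤+ (∑-mono Vs λ y → ∑-mono (Finite.enum (finVec m)) λ x →
             𝟙-mono (solves? u d (y ∷ x)) (solves? (u ∘ suc) d x) (solves-tail {u = u} {d} {y} {x} u₀≈0)) ⟩
      v * ∑ Vs (λ y → ∑ (Finite.enum (finVec m)) (λ x → 𝟙 (solves? (u ∘ suc) d x)))
        ≡⟨ cong (v *_) (∑-const Vs (∑ (Finite.enum (finVec m)) (λ x → 𝟙 (solves? (u ∘ suc) d x)))) ⟩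
      v * (v * ∑ (Finite.enum (finVec m)) (λ x → 𝟙 (solves? (u ∘ suc) d x)))
        ≤⟨ *-monoˡ {v} 0≤+ (solutions≤ m (u ∘ suc) d (k , uk≉0)) ⟩
      v * Finite.∣∣ (finVec m)
        ≡⟨ sym (∣vec∣ finV m) ⟩
      Finite.∣∣ (finVec (suc m)) ∎
      where open ≤-Reasoning

    ∣R∣≡ : ∣R∣ ≡ v * v
    ∣R∣≡ = ∣product∣ finV finV

    fibre≤ : ∀ x s → ∑ Rs (λ r → 𝟙 (φ r x ≟V s)) ≤ v
    fibre≤ x s = begin
      ∑ Rs (λ r → 𝟙 (φ r x ≟V s))                         ≡⟨ ∑-product finV finV (λ r → 𝟙 (φ r x ≟V s)) ⟩
      ∑ Vs (λ c → ∑ Vs (λ p → 𝟙 (φ (c , p) x ≟V s)))      ≤⟨ ∑-mono Vs (λ c → Finite.∑-𝟙-unique≤1 finV (λ p → φ (c , p) x ≟V s)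
                                                                (λ eq eq′ → φ-injectiveʳ {c} x (trans eq (sym eq′)))) ⟩
      ∑ Vs (λ _ → 1ℤ)                                     ≡⟨ ∑-1 Vs ⟩
      v                                                   ∎
      where open ≤-Reasoning

    -- If c = c′ then p ≠ p′ and there is no collision at all. Otherwise a collision is the linear
    -- equation (c - c′) x = p′ - p with a nonzero coefficient.
    collision≤ : ∀ {r r′} → r ≢ r′ → v * ∑ Xs (λ x → 𝟙 (φ r x ≟V φ r′ x)) ≤ ∣X∣
    collision≤ {c , p} {c′ , p′} r≢r′ with c ≟V c′
    ... | yes refl = subst (_≤ ∣X∣) (sym (trans (cong (v *_) (trans (∑-cong Xs λ x → 𝟙-no (φ (c , p) x ≟V φ (c , p′) x)
                       λ eq → r≢r′ (cong (c ,_) (φ-injectiveʳ {c} x eq))) (∑-zero Xs))) (*-zeroʳ v))) 0≤+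
    ... | no c≢c′ = ≤-trans
        (*-monoˡ {v} 0≤+ (∑-mono Xs λ x → 𝟙-mono (φ (c , p) x ≟V φ (c′ , p′) x) (solves? u d x) (φ-collision {c} {p} {c′} {p′} x)))
        (solutions≤ n u d (¬∀⟶∃¬ n _ (λ k → u k ≟F 0#) λ u≈0 → c≢c′ (val-injective λ k → difference≈0 (u≈0 k))))
      where
      u d : Fin n → Carrier
      u k = val c k -F val c′ k
      d j = val p′ j -F val p j

    -- The fibre bound is `k` = `v`, as p is determined by c, x and the value. The saving in
    -- `discrepancy²≤` is therefore q^n.
    open UniversalHash finR finX finV φ v 0≤+ fibre≤ collision≤ (≤-reflexive ∣R∣≡) public

    kernelSize : Vec V n → ℤ
    kernelSize x = ∑ Vs (λ u → 𝟙 (φ (u , 0V) x ≟V φ (0V , 0V) x))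

    instance
      order-nonZero : ℕ.NonZero order
      order-nonZero = ℕ.≢-nonZero order≢0

    v-positive : Positive v
    v-positive = subst Positive (sym v≡) (positive-^ (ℕ.>-nonZero⁻¹ _ {{m^n≢0 order n}}))
      where
      positive-^ : ∀ {m} → 0 ℕ.< m → Positive (+ m)
      positive-^ (ℕ.s≤s _) = _

    -- On average a kernel has at most two elements: the zero vector contributes one, and each of
    -- the `v` vectors at most 1/v by the collision bound.
    ∑-kernelSize≤ : ∑ Xs kernelSize ≤ + 2 * ∣X∣
    ∑-kernelSize≤ = *-cancelˡ-≤-pos (∑ Xs kernelSize) (+ 2 * ∣X∣) v {{v-positive}} (begin
      v * ∑ Xs kernelSize
        ≡⟨ cong (v *_) (∑-swap Xs Vs (λ x u → 𝟙 (φ (u , 0V) x ≟V φ (0V , 0V) x))) ⟩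
      v * ∑ Vs (λ u → ∑ Xs (λ x → 𝟙 (φ (u , 0V) x ≟V φ (0V , 0V) x)))
        ≡⟨ sym (∑-distribˡ-* Vs v (λ u → ∑ Xs (λ x → 𝟙 (φ (u , 0V) x ≟V φ (0V , 0V) x)))) ⟩
      ∑ Vs (λ u → v * ∑ Xs (λ x → 𝟙 (φ (u , 0V) x ≟V φ (0V , 0V) x)))
        ≤⟨ ∑-mono Vs (λ u → collisions≤ (0V , 0V) (u , 0V)) ⟩
      ∑ Vs (λ u → ∣X∣ + 𝟙 (Finite._≟_ finR (0V , 0V) (u , 0V)) * (v * ∣X∣))
        ≤⟨ ∑-mono Vs (λ u → +-monoʳ-≤ ∣X∣ (*-monoʳ (*-nonNeg {v} {∣X∣} 0≤+ 0≤+)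
             (𝟙-mono (Finite._≟_ finR (0V , 0V) (u , 0V)) (0V ≟V u) (λ { refl → refl })))) ⟩
      ∑ Vs (λ u → ∣X∣ + 𝟙 (0V ≟V u) * (v * ∣X∣))
        ≡⟨ ∑-distrib-+ Vs (λ _ → ∣X∣) (λ u → 𝟙 (0V ≟V u) * (v * ∣X∣)) ⟩
      ∑ Vs (λ _ → ∣X∣) + ∑ Vs (λ u → 𝟙 (0V ≟V u) * (v * ∣X∣))
        ≡⟨ cong₂ _+_ (∑-const Vs ∣X∣) (Finite.∑-δ finV 0V (λ _ → v * ∣X∣)) ⟩
      v * ∣X∣ + v * ∣X∣
        ≡⟨ double v ∣X∣ ⟩
      v * (+ 2 * ∣X∣) ∎)
      where
      open ≤-Reasoning
      double : ∀ v x → v * x + v * x ≡ v * (+ 2 * x)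
      double = solve-∀

    -- A nonzero kernel vector brings its q distinct scalar multiples with it.
    kernelSize<⇒regular : ∀ {B : Mat} → ¬ (+ order ≤ kernelSize (codeM B)) → Regular B
    kernelSize<⇒regular {B} small u uB≈0 k with u k ≟F 0#
    ... | yes uk≈0 = uk≈0
    ... | no  uk≉0 = ⊥-elim (small (begin
      + order
        ≡⟨ cong +_ (sym (length-tabulate {n = order} id)) ⟩
      + length (allFin order)
        ≡⟨ sym (∑-1 (allFin order)) ⟩
      ∑ (allFin order) (λ _ → 1ℤ)
        ≡⟨ ∑-cong (allFin order) (λ t → sym (𝟙-yes (kernel? (scale u t)) (inKernel-scale {B} uB≈0 t))) ⟩
      ∑ (allFin order) (λ t → 𝟙 (kernel? (scale u t)))
        ≡⟨ sym (∑-map (scale u) (allFin order) (λ w → 𝟙 (kernel? w))) ⟩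
      ∑ (map (scale u) (allFin order)) (λ w → 𝟙 (kernel? w))
        ≤⟨ Finite.∑-unique≤ finV Vs (λ w → 0≤𝟙 (kernel? w)) (map⁺ (scale-injective {u} uk≉0) (allFin⁺ order)) (λ _ → Finite.complete finV _) ⟩
      kernelSize (codeM B) ∎))
      where
      open ≤-Reasoning
      kernel? : ∀ w → Dec (InKernel (codeM B) w)
      kernel? w = φ (w , 0V) (codeM B) ≟V φ (0V , 0V) (codeM B)

-- Counting the solutions of c b + p = s b

module Incidences where
  open Sums
  open Hashing
  open Coding
  open Counting
  open import Data.Integer using (ℤ; +_; 0ℤ; 1ℤ; ∣_∣; _+_; _*_; _-_; _≤_; _≤?_; _⊖_; _^_)
  open import Data.Integer.Properties hiding (_≟_; _≤?_)
  open import Data.Integer.Tactic.RingSolver using (solve-∀)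
  open import Data.Nat as ℕ using (ℕ; zero; suc)
  import Data.Nat.Properties as ℕ
  open import Data.List using (List; []; _∷_; map; length; filter; concatMap; cartesianProductWith)
  open import Data.List.Properties using (length-++; length-map)
  open import Data.List.Membership.Propositional using (_∈_)
  open import Data.List.Membership.Propositional.Properties
  open import Data.List.Relation.Unary.All as All using (All; []; _∷_)
  open import Data.List.Relation.Unary.All.Properties using (all-filter)
  open import Data.List.Relation.Unary.Any as Any using (Any)
  import Data.List.Relation.Unary.Any.Properties as Any
  open import Data.List.Relation.Unary.AllPairs as AllPairs using (AllPairs; []; _∷_)
  import Data.List.Relation.Unary.AllPairs.Properties as AllPairs
  open import Data.List.Relation.Unary.Unique.Propositional using (Unique)
  import Data.List.Relation.Unary.Unique.Propositional.Properties as Unique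
  open import Data.List.Relation.Unary.Unique.DecSetoid.Properties using (deduplicate-!)
  open import Data.Product using (∃; _×_; _,_; proj₁; proj₂)
  open import Data.Sum using (_⊎_; inj₁; inj₂)
  open import Data.Vec as Vec using (Vec; zip)
  open import Data.Vec.Properties using (map-proj₁-zip; map-proj₂-zip)
  open import Function using (_∘_)
  open import Relation.Binary using (DecSetoid)
  open import Relation.Nullary using (¬_; ¬?; Dec; yes; no)
  open import Relation.Binary.PropositionalEquality

  private variable
    K L M : Set

  zip-injective : ∀ {m} {as as′ : Vec K m} {bs bs′ : Vec L m} → zip as bs ≡ zip as′ bs′ → as ≡ as′ × bs ≡ bs′
  zip-injective {as = as} {as′} {bs} {bs′} eq =
    trans (sym (map-proj₁-zip as bs)) (trans (cong (Vec.map proj₁) eq) (map-proj₁-zip as′ bs′)) ,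
    trans (sym (map-proj₂-zip as bs)) (trans (cong (Vec.map proj₂) eq) (map-proj₂-zip as′ bs′))

  length-cartesianProductWith : ∀ (f : K → L → M) xs ys → length (cartesianProductWith f xs ys) ≡ length xs ℕ.* length ys
  length-cartesianProductWith f []       ys = refl
  length-cartesianProductWith f (x ∷ xs) ys = trans (length-++ (map (f x) ys))
    (cong₂ ℕ._+_ (length-map (f x) ys) (length-cartesianProductWith f xs ys))

  -- Injectivity is asked only at the listed x, because `line b` separates different s only for
  -- regular b.
  unique-cartesianProductWith : ∀ {f : K → L → M} {xs ys} →
    AllPairs (λ x x′ → ∀ y y′ → f x y ≢ f x′ y′) xs → All (λ x → Unique (map (f x) ys)) xs →
    Unique (cartesianProductWith f xs ys)
  unique-cartesianProductWith []         []       = []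
  unique-cartesianProductWith {f = f} {x ∷ xs} {ys} (x# ∷ xs#) (u ∷ us) =
    Unique.++⁺ u (unique-cartesianProductWith xs# us) disjoint
    where
    disjoint : ∀ {z} → ¬ (z ∈ map (f x) ys × z ∈ cartesianProductWith f xs ys)
    disjoint (z∈₁ , z∈₂) with ∈-map⁻ (f x) z∈₁ | ∈-cartesianProductWith⁻ f xs ys z∈₂
    ... | y , _ , refl | x′ , y′ , x′∈xs , _ , eq = All.lookup x# x′∈xs y y′ eq

  length-filter : ∀ {P : K → Set} (P? : ∀ x → Dec (P x)) xs → + length xs ≡ + length (filter (¬? ∘ P?) xs) + ∑ xs (λ x → 𝟙 (P? x))
  length-filter P? []       = refl
  length-filter P? (x ∷ xs) with P? x
  ... | yes _ = trans (cong (_+_ 1ℤ) (length-filter P? xs)) (lemma (+ length (filter (¬? ∘ P?) xs)) (∑ xs (λ x → 𝟙 (P? x))))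
    where
    lemma : ∀ a b → 1ℤ + (a + b) ≡ a + (1ℤ + b)
    lemma = solve-∀
  ... | no _  = trans (cong (_+_ 1ℤ) (length-filter P? xs)) (lemma (+ length (filter (¬? ∘ P?) xs)) (∑ xs (λ x → 𝟙 (P? x))))
    where
    lemma : ∀ a b → 1ℤ + (a + b) ≡ 1ℤ + a + (0ℤ + b)
    lemma = solve-∀

  ^-distribʳ-* : ∀ m a b → (a ℕ.* b) ℕ.^ m ≡ a ℕ.^ m ℕ.* b ℕ.^ m
  ^-distribʳ-* zero    a b = refl
  ^-distribʳ-* (suc m) a b = trans (cong (a ℕ.* b ℕ.*_) (^-distribʳ-* m a b)) (ℕ.[m*n]*[o*p]≡[m*o]*[n*p] a b (a ℕ.^ m) (b ℕ.^ m))

  pos-^ : ∀ a m → (+ a) ^ m ≡ + (a ℕ.^ m)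
  pos-^ a zero    = refl
  pos-^ a (suc m) = trans (cong (+ a *_) (pos-^ a m)) (sym (pos-* a (a ℕ.^ m)))

  module SumProduct (F : FiniteField) (n : ℕ) (A : List (Matrices.Mat F n)) (A! : Matrices.IsSet F n A) where
    open FiniteField F using (order) renaming (refl to ≈-refl; sym to ≈-sym; trans to ≈-trans)
    open Matrices F n
    open FieldAlgebra F n
    open FieldCounting F n

    matDecSetoid : DecSetoid _ _
    matDecSetoid = record
      { _≈_ = _≈M_
      ; isDecEquivalence = record
        { isEquivalence = record
          { refl  = λ _ _ → ≈-refl
          ; sym   = λ X≈Y i j → ≈-sym (X≈Y i j)
          ; trans = λ X≈Y Y≈Z i j → ≈-trans (X≈Y i j) (Y≈Z i j)
          }
        ; _≟_ = _≟M_
        }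
      }

    -- Membership in `B` is tested by kernel size because that is a decidable number whose total is
    -- bounded; the threshold q forces regularity.
    S P B : List Mat
    S = image₂ _+M_ A
    P = image₂ _*M_ A
    B = filter (¬? ∘ λ b → + order ≤? kernelSize (codeM b)) A

    unique-codes : ∀ {Xs} → IsSet Xs → Unique (map codeM Xs)
    unique-codes = AllPairs.map⁺ ∘ AllPairs.map (λ X≉Y eq → X≉Y (codeM-injective eq))

    image₂-unique : ∀ op → IsSet (image₂ op A)
    image₂-unique op = deduplicate-! matDecSetoid (concatMap (λ a → map (op a) A) A)

    image₂-∈ : ∀ op {X Y} → X ∈ A → Y ∈ A → Any (op X Y ≈M_) (image₂ op A)
    image₂-∈ op {X} {Y} X∈A Y∈A = Any.deduplicate⁺ _≟M_ (λ Z≈Y eq i j → ≈-trans (eq i j) (≈-sym (Z≈Y i j)))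
      (Any.map (λ { refl _ _ → ≈-refl }) (∈-concatMap⁺ (λ a → map (op a) A) (Any.map (λ { refl → ∈-map⁺ (op X) Y∈A }) X∈A)))

    B-regular : ∀ {b} → b ∈ B → Regular b
    B-regular {b} b∈B = kernelSize<⇒regular {b} (All.lookup (all-filter (¬? ∘ λ b → + order ≤? kernelSize (codeM b)) A) b∈B)

    B! : IsSet B
    B! = AllPairs.filter⁺ (¬? ∘ λ b → + order ≤? kernelSize (codeM b)) A!

    finRⁿ : Finite (Vec (V × V) n)
    finRⁿ = vecFinite finR n

    finX² : Finite (Vec V n × Vec V n)
    finX² = productFinite finX finX

    open Finite finX using () renaming (enum to Xs; ∣∣ to ∣X∣; _≟_ to _≟X_)
    open Finite finV using () renaming (∣∣ to v)

    points : List (Vec (V × V) n)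
    points = cartesianProductWith zip (map codeM A) (map codeM P)

    points! : Unique points
    points! = Unique.cartesianProductWith⁺ zip zip-injective (unique-codes A!) (unique-codes (image₂-unique _*M_))

    -- It stores s b instead of s: this is the value that the rows of c b + p have to hit.
    line : Mat → Mat → Vec V n × Vec V n
    line b s = codeM b , codeM (s *M b)

    lines : List (Vec V n × Vec V n)
    lines = cartesianProductWith line B S

    lines! : Unique lines
    lines! = unique-cartesianProductWith
      (AllPairs.map (λ b≉b′ _ _ eq → b≉b′ (codeM-injective (cong proj₁ eq))) B!)
      (All.tabulate λ b∈B → AllPairs.map⁺ (AllPairs.map
        (λ s≉s′ eq → s≉s′ (regular-cancel (B-regular b∈B) (codeM-injective (cong proj₂ eq)))) (image₂-unique _+M_)))

    f : Vec (V × V) n → ℤ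
    f = Finite.count finRⁿ points

    g : Vec V n → Vec V n → ℤ
    g x s = Finite.count finX² lines (x , s)

    ‖f‖²≤ : ‖ f ‖² ≤ + length points
    ‖f‖²≤ = Finite.∑-count² finRⁿ points!

    ‖g‖²≤ : ‖ g ‖ₓ² ≤ + length lines
    ‖g‖²≤ = subst (_≤ + length lines) (∑-product finX finX (λ k → Finite.count finX² lines k * Finite.count finX² lines k))
      (Finite.∑-count² finX² lines!)

    ∑-count-1 : ∀ {K : Set} (fin : Finite K) l → ∑ (Finite.enum fin) (Finite.count fin l) ≡ + length l
    ∑-count-1 fin l = trans (∑-cong (Finite.enum fin) λ k → sym (*-identityʳ (Finite.count fin l k)))
      (trans (Finite.∑-count fin l (λ _ → 1ℤ)) (∑-1 l))

    W≡ : W n f g ≡ + (length points ℕ.* length lines)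
    W≡ = trans (cong₂ _*_ (∑-count-1 finRⁿ points) (trans (sym (∑-product finX finX (Finite.count finX² lines))) (∑-count-1 finX² lines)))
      (sym (pos-* (length points) (length lines)))

    Incident : Vec (V × V) n → Vec V n × Vec V n → Set
    Incident w (x , y) = y ≡ φ* w x

    incident? : ∀ w l → Dec (Incident w l)
    incident? w (x , y) = y ≟X φ* w x

    -- A line incident to w is one of the pairs (x, `φ* w x`); summing over x brings the count into
    -- the shape of `T`.
    line≤ : ∀ w l → 𝟙 (incident? w l) ≤ ∑ Xs (λ x → 𝟙 (Finite._≟_ finX² l (x , φ* w x)))
    line≤ w (b , y) = begin
      𝟙 (y ≟X φ* w b)                                          ≡⟨ sym (Finite.∑-δ finX b (λ x → 𝟙 (y ≟X φ* w x))) ⟩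
      ∑ Xs (λ x → 𝟙 (b ≟X x) * 𝟙 (y ≟X φ* w x))                ≤⟨ ∑-mono Xs (λ x → both (b ≟X x) (y ≟X φ* w x) (Finite._≟_ finX² (b , y) (x , φ* w x))) ⟩
      ∑ Xs (λ x → 𝟙 (Finite._≟_ finX² (b , y) (x , φ* w x)))   ∎
      where
      open ≤-Reasoning
      both : ∀ {x z} (d : Dec (b ≡ x)) (d′ : Dec (y ≡ z)) (d″ : Dec ((b , y) ≡ (x , z))) → 𝟙 d * 𝟙 d′ ≤ 𝟙 d″
      both (yes refl) (yes refl) d″ = ≤-reflexive (sym (𝟙-yes d″ refl))
      both (yes _)    (no _)     d″ = 0≤𝟙 d″
      both (no _)     (yes _)    d″ = 0≤𝟙 d″
      both (no _)     (no _)     d″ = 0≤𝟙 d″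

    incidences≤T : ∑ points (λ w → ∑ lines (λ l → 𝟙 (incident? w l))) ≤ T n f g
    incidences≤T = begin
      ∑ points (λ w → ∑ lines (λ l → 𝟙 (incident? w l)))
        ≤⟨ ∑-mono points (λ w → ∑-mono lines (line≤ w)) ⟩
      ∑ points (λ w → ∑ lines (λ l → ∑ Xs (λ x → 𝟙 (Finite._≟_ finX² l (x , φ* w x)))))
        ≡⟨ ∑-cong points (λ w → ∑-swap lines Xs (λ l x → 𝟙 (Finite._≟_ finX² l (x , φ* w x)))) ⟩
      ∑ points (λ w → ∑ Xs (λ x → g x (φ* w x)))
        ≡⟨ sym (Finite.∑-count finRⁿ points (λ w → ∑ Xs (λ x → g x (φ* w x)))) ⟩
      ∑ (Finite.enum finRⁿ) (λ w → f w * ∑ Xs (λ x → g x (φ* w x)))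
        ≡⟨ ∑-cong (Finite.enum finRⁿ) (λ w → sym (∑-distribˡ-* Xs (f w) (λ x → g x (φ* w x)))) ⟩
      ∑ (Finite.enum finRⁿ) (λ w → ∑ Xs (λ x → f w * g x (φ* w x)))
        ≡⟨ ∑-swap (Finite.enum finRⁿ) Xs (λ w x → f w * g x (φ* w x)) ⟩
      T n f g ∎
      where open ≤-Reasoning

    code∈ : ∀ {X : Mat} {Ys} (h : Mat → Vec V n) → (∀ {Y} → X ≈M Y → h X ≡ h Y) → Any (X ≈M_) Ys → h X ∈ map h Ys
    code∈ h h-cong = Any.map⁺ ∘ Any.map h-cong

    -- Every a ∈ A yields the solution p = a b, s = a + c of c b + p = s b.
    incidences-per-pair : ∀ {c b} → c ∈ A → b ∈ B →
      + length A ≤ ∑ (map codeM P) (λ p → ∑ S (λ s → 𝟙 (incident? (zip (codeM c) p) (line b s))))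
    incidences-per-pair {c} {b} c∈A b∈B = begin
      + length A
        ≡⟨ sym (∑-1 A) ⟩
      ∑ A (λ _ → 1ℤ)
        ≤⟨ ∑-mono-∈ A (λ {a} a∈A → ∑-𝟙-∈ (λ p → meets? p (shift a)) (map codeM P)
             (code∈ codeM codeM-cong (image₂-∈ _*M_ a∈A (∈-filter-⊆ b∈B))) (sym (trans (φ-matrix c (a *M b) b) (codeM-cong (sum-product a b c))))) ⟩
      ∑ A (λ a → h (shift a))
        ≡⟨ sym (∑-map shift A h) ⟩
      ∑ (map shift A) h
        ≤⟨ Finite.∑-unique≤ finX (map (λ s → codeM (s *M b)) S) (λ y → ∑-nonNeg (map codeM P) (λ p → 0≤𝟙 (meets? p y))) shifts! shifts⊆ ⟩
      ∑ (map (λ s → codeM (s *M b)) S) h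
        ≡⟨ ∑-map (λ s → codeM (s *M b)) S h ⟩
      ∑ S (λ s → h (codeM (s *M b)))
        ≡⟨ ∑-swap S (map codeM P) (λ s p → 𝟙 (meets? p (codeM (s *M b)))) ⟩
      ∑ (map codeM P) (λ p → ∑ S (λ s → 𝟙 (incident? (zip (codeM c) p) (line b s)))) ∎
      where
      open ≤-Reasoning
      meets? : ∀ p y → Dec (Incident (zip (codeM c) p) (codeM b , y))
      meets? p y = incident? (zip (codeM c) p) (codeM b , y)
      h : Vec V n → ℤ
      h y = ∑ (map codeM P) (λ p → 𝟙 (meets? p y))
      shift : Mat → Vec V n
      shift a = codeM ((a +M c) *M b)
      ∈-filter-⊆ : ∀ {b} → b ∈ B → b ∈ A
      ∈-filter-⊆ b∈B = proj₁ (∈-filter⁻ (¬? ∘ λ b → + order ≤? kernelSize (codeM b)) b∈B)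
      -- Regularity of b is what keeps the |A| values (a + c) b apart.
      shifts! : Unique (map shift A)
      shifts! = AllPairs.map⁺ (AllPairs.map (λ a≉a′ eq → a≉a′ (+M-cancelʳ c (regular-cancel (B-regular b∈B) (codeM-injective eq)))) A!)
      shifts⊆ : ∀ {y} → y ∈ map shift A → y ∈ map (λ s → codeM (s *M b)) S
      shifts⊆ y∈ with ∈-map⁻ shift y∈
      ... | a , a∈A , refl = code∈ (λ s → codeM (s *M b))
        (λ X≈Y → codeM-cong λ i j → lin-cong {x = b} (X≈Y i) (λ _ _ → ≈-refl) j)
        (image₂-∈ _+M_ a∈A c∈A)

    many-incidences : + (length A ℕ.* (length B ℕ.* length A)) ≤ T n f g
    many-incidences = begin
      + (length A ℕ.* (length B ℕ.* length A))
        ≡⟨ trans (pos-* (length A) (length B ℕ.* length A)) (cong (+ length A *_) (pos-* (length B) (length A))) ⟩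
      + length A * (+ length B * + length A)
        ≡⟨ sym (trans (∑-cong A λ _ → ∑-const B (+ length A)) (∑-const A (+ length B * + length A))) ⟩
      ∑ A (λ c → ∑ B (λ b → + length A))
        ≤⟨ ∑-mono-∈ A (λ c∈A → ∑-mono-∈ B (λ b∈B → incidences-per-pair c∈A b∈B)) ⟩
      ∑ A (λ c → ∑ B (λ b → ∑ (map codeM P) (λ p → ∑ S (λ s → 𝟙 (incident? (zip (codeM c) p) (line b s))))))
        ≡⟨ ∑-cong A (λ c → ∑-swap B (map codeM P) (λ b p → ∑ S (λ s → 𝟙 (incident? (zip (codeM c) p) (line b s))))) ⟩
      ∑ A (λ c → ∑ (map codeM P) (λ p → ∑ B (λ b → ∑ S (λ s → 𝟙 (incident? (zip (codeM c) p) (line b s))))))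
        ≡⟨ ∑-cong A (λ c → ∑-cong (map codeM P) (λ p → sym (∑-cartesianProductWith line B S (λ l → 𝟙 (incident? (zip (codeM c) p) l))))) ⟩
      ∑ A (λ c → ∑ (map codeM P) (λ p → I (zip (codeM c) p)))
        ≡⟨ sym (∑-map codeM A (λ c → ∑ (map codeM P) (λ p → I (zip c p)))) ⟩
      ∑ (map codeM A) (λ c → ∑ (map codeM P) (λ p → I (zip c p)))
        ≡⟨ sym (∑-cartesianProductWith zip (map codeM A) (map codeM P) I) ⟩
      ∑ points I
        ≤⟨ incidences≤T ⟩
      T n f g ∎
      where
      open ≤-Reasoning
      I : Vec (V × V) n → ℤ
      I w = ∑ lines (λ l → 𝟙 (incident? w l))

    Q : ℕ
    Q = (order ℕ.^ n) ℕ.^ n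

    w : ℕ
    w = length A ℕ.* length P ℕ.* (length B ℕ.* length S)

    w≡ : length points ℕ.* length lines ≡ w
    w≡ = cong₂ ℕ._*_
      (trans (length-cartesianProductWith zip (map codeM A) (map codeM P)) (cong₂ ℕ._*_ (length-map codeM A) (length-map codeM P)))
      (length-cartesianProductWith line B S)

    bound≡ : bound n ≡ + (Q ℕ.* Q ℕ.* Q ℕ.* Q)
    bound≡ = begin
      (v * v * v) ^ n * ∣X∣       ≡⟨ cong₂ _*_ (trans (cong (_^ n) vvv≡) (pos-^ (q ℕ.* q ℕ.* q) n)) ∣X∣≡ ⟩
      + ((q ℕ.* q ℕ.* q) ℕ.^ n) * + Q ≡⟨ sym (pos-* ((q ℕ.* q ℕ.* q) ℕ.^ n) Q) ⟩
      + ((q ℕ.* q ℕ.* q) ℕ.^ n ℕ.* Q) ≡⟨ cong (λ z → + (z ℕ.* Q)) (trans (^-distribʳ-* n (q ℕ.* q) q) (cong (ℕ._* Q) (^-distribʳ-* n q q))) ⟩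
      + (Q ℕ.* Q ℕ.* Q ℕ.* Q) ∎
      where
      open ≡-Reasoning
      q = order ℕ.^ n
      vvv≡ : v * v * v ≡ + (q ℕ.* q ℕ.* q)
      vvv≡ = trans (cong (λ z → z * z * z) v≡) (sym (trans (pos-* (q ℕ.* q) q) (cong (_* + q) (pos-* q q))))

    τ : ℕ
    τ = ∣ T n f g ∣

    T≡ : + τ ≡ T n f g
    T≡ = 0≤i⇒+∣i∣≡i (≤-trans 0≤+ many-incidences)

    many≤τ : length A ℕ.* (length B ℕ.* length A) ℕ.≤ τ
    many≤τ = drop‿+≤+ (subst (+ (length A ℕ.* (length B ℕ.* length A)) ≤_) (sym T≡) many-incidences)

    -- Either the count is at most twice its expected value w / Q, or more than half of `Q * τ` is
    -- error and `discrepancy²≤` applies. Here `Q` is q^(n²).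
    dichotomy :
      let N = Q ℕ.* (length A ℕ.* (length B ℕ.* length A)) in
      N ℕ.≤ 2 ℕ.* w ⊎
      ∃ λ ε → N ℕ.≤ 2 ℕ.* ε × order ℕ.^ n ℕ.* (ε ℕ.* ε) ℕ.≤ ∣ κ n ∣ ℕ.* (Q ℕ.* Q ℕ.* Q ℕ.* Q ℕ.* w)
    dichotomy with Q ℕ.* τ ℕ.≤? 2 ℕ.* w
    ... | yes QT≤2w = inj₁ (ℕ.≤-trans (ℕ.*-monoʳ-≤ Q many≤τ) QT≤2w)
    ... | no QT≰2w = inj₂ (ε , ℕ.≤-trans (ℕ.*-monoʳ-≤ Q many≤τ) QT≤2ε , drop‿+≤+ main)
      where
      ε : ℕ
      -- The subtraction does not truncate: in this case w ≤ 2 w ≤ Q τ.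
      ε = Q ℕ.* τ ℕ.∸ w
      2w≤ : 2 ℕ.* w ℕ.≤ Q ℕ.* τ
      2w≤ = ℕ.<⇒≤ (ℕ.≰⇒> QT≰2w)
      w≤ : w ℕ.≤ Q ℕ.* τ
      w≤ = ℕ.≤-trans (ℕ.m≤m+n w (w ℕ.+ 0)) 2w≤
      QT≤2ε : Q ℕ.* τ ℕ.≤ 2 ℕ.* ε
      QT≤2ε = ℕ.+-cancelʳ-≤ (2 ℕ.* w) (Q ℕ.* τ) (2 ℕ.* ε) (begin
        Q ℕ.* τ ℕ.+ 2 ℕ.* w      ≤⟨ ℕ.+-monoʳ-≤ (Q ℕ.* τ) 2w≤ ⟩
        Q ℕ.* τ ℕ.+ Q ℕ.* τ      ≡⟨ cong (Q ℕ.* τ ℕ.+_) (sym (ℕ.+-identityʳ (Q ℕ.* τ))) ⟩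
        2 ℕ.* (Q ℕ.* τ)          ≡⟨ cong (2 ℕ.*_) (sym (ℕ.m∸n+n≡m w≤)) ⟩
        2 ℕ.* (ε ℕ.+ w)          ≡⟨ ℕ.*-distribˡ-+ 2 ε w ⟩
        2 ℕ.* ε ℕ.+ 2 ℕ.* w      ∎)
        where open ℕ.≤-Reasoning
      discrepancy≡ : discrepancy n f g ≡ + ε
      discrepancy≡ = begin
        v ^ n * T n f g - W n f g   ≡⟨ cong₂ _-_ (cong₂ _*_ (trans (cong (_^ n) v≡) (pos-^ (order ℕ.^ n) n)) (sym T≡)) (trans W≡ (cong +_ w≡)) ⟩
        + Q * + τ - + w             ≡⟨ cong (_- + w) (sym (pos-* Q τ)) ⟩
        + (Q ℕ.* τ) - + w           ≡⟨ m-n≡m⊖n (Q ℕ.* τ) w ⟩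
        Q ℕ.* τ ⊖ w    ≡⟨ ⊖-≥ w≤ ⟩
        + ε                         ∎
        where open ≡-Reasoning
      main : + (order ℕ.^ n ℕ.* (ε ℕ.* ε)) ≤ + (∣ κ n ∣ ℕ.* (Q ℕ.* Q ℕ.* Q ℕ.* Q ℕ.* w))
      main = begin
        + (order ℕ.^ n ℕ.* (ε ℕ.* ε))
          ≡⟨ trans (pos-* (order ℕ.^ n) (ε ℕ.* ε)) (cong₂ _*_ (sym v≡) (pos-* ε ε)) ⟩
        v * (+ ε * + ε)
          ≡⟨ cong (λ z → v * (z * z)) (sym discrepancy≡) ⟩
        v * (discrepancy n f g * discrepancy n f g)
          ≤⟨ discrepancy²≤ n f (Finite.0≤count finRⁿ points) g ⟩
        κ n * (bound n * (‖ f ‖² * ‖ g ‖ₓ²))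
          ≤⟨ *-monoˡ (0≤κ n) (*-monoˡ (subst (0ℤ ≤_) (sym bound≡) 0≤+) (*-mono (∑-nonNeg (Finite.enum finRⁿ) λ w → 0≤sq (f w)) 0≤+ ‖f‖²≤ ‖g‖²≤)) ⟩
        κ n * (bound n * (+ length points * + length lines))
          ≡⟨ cong₂ _*_ (sym (0≤i⇒+∣i∣≡i (0≤κ n))) (cong₂ _*_ bound≡ (trans (sym (pos-* (length points) (length lines))) (cong +_ w≡))) ⟩
        + ∣ κ n ∣ * (+ (Q ℕ.* Q ℕ.* Q ℕ.* Q) * + w)
          ≡⟨ sym (trans (pos-* ∣ κ n ∣ (Q ℕ.* Q ℕ.* Q ℕ.* Q ℕ.* w)) (cong (+ ∣ κ n ∣ *_) (pos-* (Q ℕ.* Q ℕ.* Q ℕ.* Q) w))) ⟩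
        + (∣ κ n ∣ ℕ.* (Q ℕ.* Q ℕ.* Q ℕ.* Q ℕ.* w)) ∎
        where open ≤-Reasoning

    -- Markov's inequality: each removed matrix has kernel size at least q, while all kernel sizes
    -- together are at most 2 q^(n²).
    singular≤ : ∃ λ r → length A ≡ length B ℕ.+ r × order ℕ.* r ℕ.≤ 2 ℕ.* Q
    singular≤ = ∣ r ∣ , +-injective (trans (length-filter big? A) (trans (cong (_+_ (+ length B)) (sym r≡)) (sym (pos-+ (length B) ∣ r ∣)))) ,
      drop‿+≤+ (begin
      + (order ℕ.* ∣ r ∣)                            ≡⟨ trans (pos-* order ∣ r ∣) (cong (+ order *_) r≡) ⟩
      + order * r                                    ≡⟨ sym (∑-distribˡ-* A (+ order) (λ b → 𝟙 (big? b))) ⟩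
      ∑ A (λ b → + order * 𝟙 (big? b))               ≤⟨ ∑-mono A (λ b → markov (kernelSize (codeM b)) (0≤kernelSize (codeM b)) (big? b)) ⟩
      ∑ A (λ b → kernelSize (codeM b))               ≡⟨ sym (∑-map codeM A kernelSize) ⟩
      ∑ (map codeM A) kernelSize                     ≤⟨ Finite.∑-unique≤ finX Xs 0≤kernelSize (unique-codes A!) (λ _ → Finite.complete finX _) ⟩
      ∑ Xs kernelSize                                ≤⟨ ∑-kernelSize≤ ⟩
      + 2 * ∣X∣                                      ≡⟨ trans (cong (+ 2 *_) ∣X∣≡) (sym (pos-* 2 Q)) ⟩
      + (2 ℕ.* Q)                                    ∎)
      where
      open ≤-Reasoning
      big? : ∀ b → Dec (+ order ≤ kernelSize (codeM b))
      big? b = + order ≤? kernelSize (codeM b)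
      r : ℤ
      r = ∑ A (λ b → 𝟙 (big? b))
      r≡ : + ∣ r ∣ ≡ r
      r≡ = 0≤i⇒+∣i∣≡i (∑-nonNeg A λ b → 0≤𝟙 (big? b))
      0≤kernelSize : ∀ x → 0ℤ ≤ kernelSize x
      0≤kernelSize x = ∑-nonNeg (Finite.enum finV) λ u → 0≤𝟙 (Finite._≟_ finV (φ (u , 0V) x) (φ (0V , 0V) x))
      markov : ∀ k → 0ℤ ≤ k → (d : Dec (+ order ≤ k)) → + order * 𝟙 d ≤ k
      markov k 0≤k (yes q≤k) = subst (_≤ k) (sym (*-identityʳ (+ order))) q≤k
      markov k 0≤k (no _)    = subst (_≤ k) (sym (*-zeroʳ (+ order))) 0≤k

    ∣A∣≤∣S∣ : length A ℕ.≤ length S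
    -- A nonempty A supplies some c, and the translate A + c lies in A + A. The copy `A′` is split
    -- so that `A` itself stays a parameter.
    ∣A∣≤∣S∣ = go A refl
      where
      go : ∀ A′ → A′ ≡ A → length A ℕ.≤ length S
      go []      refl = ℕ.z≤n
      go (c ∷ _) refl = drop‿+≤+ (subst₂ _≤_
        (trans (∑-1 (map (λ a → codeM (a +M c)) A)) (cong +_ (length-map _ A)))
        (trans (∑-1 (map codeM S)) (cong +_ (length-map codeM S)))
        (Finite.∑-unique≤ finX {map (λ a → codeM (a +M c)) A} (map codeM S) {λ _ → 1ℤ} (λ _ → 0≤+)
          (AllPairs.map⁺ (AllPairs.map (λ a≉a′ eq → a≉a′ (+M-cancelʳ c (codeM-injective eq))) A!))
          λ y∈ → sub (∈-map⁻ _ y∈)))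
        where
        sub : ∀ {y} → ∃ (λ a → a ∈ A × y ≡ codeM (a +M c)) → y ∈ map codeM S
        sub (a , a∈A , refl) = code∈ codeM codeM-cong (image₂-∈ _+M_ a∈A (Any.here refl))

-- From the dichotomy to the two alternatives

open Incidences
open Hashing using (κ)
open import Data.Integer using (∣_∣)
open import Data.Nat using (ℕ; suc; NonZero; _+_; _*_; _∸_; _^_; _≤_; _⊔_; z≤n; s≤s; >-nonZero; >-nonZero⁻¹)
open import Data.Nat.Properties
open import Data.Nat.Tactic.RingSolver using (solve-∀)
open import Data.List using (List; length)
open import Data.Product using (∃; ∃-syntax; _×_; _,_)
open import Data.Sum using (_⊎_; inj₁; inj₂)
open import Relation.Binary.PropositionalEquality

-- At most 2 q^(N-1) elements are removed, no more than half of `a`. This is the origin of the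
-- constant 4 in the theorem.
half≤ : ∀ {q N a b r} → NonZero q → NonZero N → a ≡ b + r → q * r ≤ 2 * q ^ N → 4 * q ^ (N ∸ 1) ≤ a → a ≤ 2 * b
half≤ {q} {suc N} {a} {b} {r} q≢0 _ refl qr≤ 4q≤ = begin
  b + r        ≤⟨ +-monoʳ-≤ b r≤b ⟩
  b + b        ≡⟨ cong (b +_) (sym (+-identityʳ b)) ⟩
  2 * b        ∎
  where
  open ≤-Reasoning
  swap : ∀ q x → 2 * (q * x) ≡ q * (2 * x)
  swap = solve-∀
  r≤ : r ≤ 2 * q ^ N
  r≤ = *-cancelˡ-≤ q {{q≢0}} (subst (q * r ≤_) (swap q (q ^ N)) qr≤)
  double : ∀ x → x + x ≡ 2 * x
  double = solve-∀
  quadruple : ∀ x → 2 * (2 * x) ≡ 4 * x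
  quadruple = solve-∀
  r≤b : r ≤ b
  r≤b = +-cancelʳ-≤ r r b (begin
    r + r              ≡⟨ double r ⟩
    2 * r              ≤⟨ *-monoʳ-≤ 2 r≤ ⟩
    2 * (2 * q ^ N)    ≡⟨ quadruple (q ^ N) ⟩
    4 * q ^ N          ≤⟨ 4q≤ ⟩
    b + r              ∎)

module Arithmetic {a b p s M : ℕ} (0<a : NonZero a) (0<b : NonZero b) (a≤2b : a ≤ 2 * b)
  (s≤M : s ≤ M) (p≤M : p ≤ M) (a≤s : a ≤ s) where

  w : ℕ
  w = a * p * (b * s)

  w≤ : w ≤ a * b * (M * M)
  w≤ = subst (_≤ a * b * (M * M)) (regroup a b p s) (*-monoʳ-≤ (a * b) (*-mono-≤ p≤M s≤M))
    where
    regroup : ∀ a b p s → a * b * (p * s) ≡ a * p * (b * s)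
    regroup = solve-∀

  instance
    ab≢0 : NonZero (a * b)
    ab≢0 = m*n≢0 a b {{0<a}} {{0<b}}

  -- Cancelling a b leaves Q a ≤ 2 M²; the factor a ≤ s ≤ M then gives the cubic form.
  main-term : ∀ {Q} → Q * (a * (b * a)) ≤ 2 * w → Q * a ^ 2 ≤ 2 * M ^ 3
  main-term {Q} h = begin
    Q * a ^ 2              ≡⟨ assoc Q a ⟩
    Q * a * a              ≤⟨ *-mono-≤ Qa≤ (≤-trans a≤s s≤M) ⟩
    2 * (M * M) * M        ≡⟨ cube M ⟩
    2 * M ^ 3              ∎
    where
    open ≤-Reasoning
    assoc : ∀ Q a → Q * (a * (a * 1)) ≡ Q * a * a
    assoc = solve-∀
    cube : ∀ M → 2 * (M * M) * M ≡ 2 * (M * (M * (M * 1)))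
    cube = solve-∀
    left : ∀ Q a b → a * b * (Q * a) ≡ Q * (a * (b * a))
    left = solve-∀
    right : ∀ x y → 2 * (x * y) ≡ x * (2 * y)
    right = solve-∀
    Qa≤ : Q * a ≤ 2 * (M * M)
    Qa≤ = *-cancelˡ-≤ (a * b) (begin
      a * b * (Q * a)          ≡⟨ left Q a b ⟩
      Q * (a * (b * a))        ≤⟨ h ⟩
      2 * w                    ≤⟨ *-monoʳ-≤ 2 w≤ ⟩
      2 * (a * b * (M * M))    ≡⟨ right (a * b) (M * M) ⟩
      a * b * (2 * (M * M))    ∎)

  -- Squaring the first bound, inserting the second and cancelling Q² a b leaves v a³ b ≤ 4 k Q² M²;
  -- trading b for a costs the last factor 2.
  error-term : ∀ {Q v k ε} → NonZero Q → Q * (a * (b * a)) ≤ 2 * ε → v * (ε * ε) ≤ k * (Q * Q * Q * Q * w) →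
               v * (a * a * a * a) ≤ 8 * k * (Q * Q) * (M * M)
  error-term {Q} {v} {k} {ε} 0<Q h h′ = begin
    v * (a * a * a * a)               ≤⟨ *-monoʳ-≤ v (*-monoʳ-≤ (a * a * a) a≤2b) ⟩
    v * (a * a * a * (2 * b))         ≡⟨ pull v a b ⟩
    2 * (v * (a * a * a * b))         ≤⟨ *-monoʳ-≤ 2 va³b≤ ⟩
    2 * (4 * k * (Q * Q) * (M * M))   ≡⟨ eight k (Q * Q) (M * M) ⟩
    8 * k * (Q * Q) * (M * M)         ∎
    where
    open ≤-Reasoning
    pull : ∀ v a b → v * (a * a * a * (2 * b)) ≡ 2 * (v * (a * a * a * b))
    pull = solve-∀
    eight : ∀ k x y → 2 * (4 * k * x * y) ≡ 8 * k * x * y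
    eight = solve-∀
    instance
      QQab≢0 : NonZero (Q * Q * (a * b))
      QQab≢0 = m*n≢0 (Q * Q) (a * b) {{m*n≢0 Q Q {{0<Q}} {{0<Q}}}}
    left : ∀ Q a b v → Q * Q * (a * b) * (v * (a * a * a * b)) ≡ v * (Q * (a * (b * a)) * (Q * (a * (b * a))))
    left = solve-∀
    mid : ∀ v ε → v * (2 * ε * (2 * ε)) ≡ 4 * (v * (ε * ε))
    mid = solve-∀
    right : ∀ Q a b k m → 4 * (k * (Q * Q * Q * Q * (a * b * m))) ≡ Q * Q * (a * b) * (4 * k * (Q * Q) * m)
    right = solve-∀
    va³b≤ : v * (a * a * a * b) ≤ 4 * k * (Q * Q) * (M * M)
    va³b≤ = *-cancelˡ-≤ (Q * Q * (a * b)) (begin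
      Q * Q * (a * b) * (v * (a * a * a * b))               ≡⟨ left Q a b v ⟩
      v * (Q * (a * (b * a)) * (Q * (a * (b * a))))         ≤⟨ *-monoʳ-≤ v (*-mono-≤ h h) ⟩
      v * (2 * ε * (2 * ε))                                 ≡⟨ mid v ε ⟩
      4 * (v * (ε * ε))                                     ≤⟨ *-monoʳ-≤ 4 h′ ⟩
      4 * (k * (Q * Q * Q * Q * w))                         ≤⟨ *-monoʳ-≤ 4 (*-monoʳ-≤ k (*-monoʳ-≤ (Q * Q * Q * Q) w≤)) ⟩
      4 * (k * (Q * Q * Q * Q * (a * b * (M * M))))         ≡⟨ right Q a b k (M * M) ⟩
      Q * Q * (a * b) * (4 * k * (Q * Q) * (M * M))         ∎)

-- One constant for both alternatives: its fourth power must dominate (8 k)² and its cube 2. The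
-- `suc` keeps it positive, so its powers increase.
constant : ℕ → ℕ
constant k = 8 * suc k

-- The square of the hypothesis carries q^(2n), and n + 1 ≤ 2 n because n is positive.
error-conclusion : ∀ n {q a M k} → NonZero n → NonZero q →
  q ^ n * (a * a * a * a) ≤ 8 * k * (q ^ (n * n) * q ^ (n * n)) * (M * M) →
  a ^ 8 * q ^ (n + 1) ≤ constant k ^ 4 * M ^ 4 * q ^ (4 * (n * n))
error-conclusion n@(suc n-1) {q} {a} {M} {k} _ q≢0 h = begin
  a ^ 8 * q ^ (n + 1)                                              ≤⟨ *-monoʳ-≤ (a ^ 8) (^-monoʳ-≤ q {{q≢0}} (+-monoʳ-≤ n (s≤s z≤n))) ⟩
  a ^ 8 * q ^ (n + n)                                              ≡⟨ cong (a ^ 8 *_) (^-distribˡ-+-* q n n) ⟩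
  a ^ 8 * (q ^ n * q ^ n)                                          ≡⟨ square a (q ^ n) ⟩
  q ^ n * (a * a * a * a) * (q ^ n * (a * a * a * a))              ≤⟨ *-mono-≤ h h ⟩
  8 * k * (Q * Q) * (M * M) * (8 * k * (Q * Q) * (M * M))          ≡⟨ regroup k Q M ⟩
  8 * k * (8 * k) * M ^ 4 * Q ^ 4                                  ≤⟨ *-mono-≤ (*-monoˡ-≤ (M ^ 4) d≤) (≤-reflexive (trans (^-*-assoc q (n * n) 4) (cong (q ^_) (*-comm (n * n) 4)))) ⟩
  constant k ^ 4 * M ^ 4 * q ^ (4 * (n * n))                       ∎
  where
  open ≤-Reasoning
  Q : ℕ
  Q = q ^ (n * n)
  square : ∀ a v → a * (a * (a * (a * (a * (a * (a * (a * 1))))))) * (v * v) ≡ v * (a * a * a * a) * (v * (a * a * a * a))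
  square = solve-∀
  regroup : ∀ k Q M → 8 * k * (Q * Q) * (M * M) * (8 * k * (Q * Q) * (M * M))
                    ≡ 8 * k * (8 * k) * (M * (M * (M * (M * 1)))) * (Q * (Q * (Q * (Q * 1))))
  regroup = solve-∀
  d≤ : 8 * k * (8 * k) ≤ constant k ^ 4
  d≤ = begin
    8 * k * (8 * k)              ≤⟨ *-mono-≤ (*-monoʳ-≤ 8 (n≤1+n k)) (*-monoʳ-≤ 8 (n≤1+n k)) ⟩
    constant k * constant k      ≡⟨ cong (constant k *_) (sym (*-identityʳ (constant k))) ⟩
    constant k ^ 2               ≤⟨ ^-monoʳ-≤ (constant k) {2} {4} (s≤s (s≤s z≤n)) ⟩
    constant k ^ 4               ∎

main-conclusion : ∀ {k x M} → x ≤ 2 * M ^ 3 → x ≤ constant k ^ 3 * M ^ 3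
main-conclusion {k} {x} {M} h = ≤-trans h (*-monoˡ-≤ (M ^ 3) (begin
  2                ≤⟨ s≤s (s≤s z≤n) ⟩
  8                ≤⟨ *-monoʳ-≤ 8 (s≤s z≤n) ⟩
  constant k       ≡⟨ sym (*-identityʳ (constant k)) ⟩
  constant k ^ 1   ≤⟨ ^-monoʳ-≤ (constant k) {1} {3} (s≤s z≤n) ⟩
  constant k ^ 3   ∎))
  where open ≤-Reasoning

-- Fractional exponents are cleared by taking the fourth power of the first bound and the cube of
-- the second. Being at least a minimum becomes a disjunction, and c(n) is 1/d.
theorem1p6 : ∀ (n : ℕ) → NonZero n →
    ∃[ C ] ∃[ d ] (NonZero C × NonZero d ×
    (∀ (F : FiniteField) (A : List (Matrices.Mat F n)) →
    Matrices.IsSet F n A →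
    C * FiniteField.order F ^ (n * n ∸ 1) ≤ Matrices.card F n A →
    (Matrices.card F n A ^ 8 * FiniteField.order F ^ (n + 1)
    ≤ d ^ 4 * (Matrices.sumsetSize F n A ⊔ Matrices.prodsetSize F n A) ^ 4 * FiniteField.order F ^ (4 * (n * n)))
    ⊎
    (FiniteField.order F ^ (n * n) * Matrices.card F n A ^ 2
    ≤ d ^ 3 * (Matrices.sumsetSize F n A ⊔ Matrices.prodsetSize F n A) ^ 3)))
theorem1p6 n n≢0 = 4 , constant ∣ κ n ∣ , _ , _ , bound
  where
  bound : ∀ (F : FiniteField) (A : List (Matrices.Mat F n)) → Matrices.IsSet F n A →
    4 * FiniteField.order F ^ (n * n ∸ 1) ≤ length A → _ ⊎ _
  bound F A A! large with SumProduct.singular≤ F n A A!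
  ... | r , a≡b+r , qr≤2Q = conclude (SumProduct.dichotomy F n A A!)
    where
    open SumProduct F n A A! using (S; P; B; Q; ∣A∣≤∣S∣)
    q = FiniteField.order F
    a = length A
    M = length S ⊔ length P
    q≢0 : NonZero q
    q≢0 = Counting.FieldCounting.order-nonZero F n
    Q≡ : Q ≡ q ^ (n * n)
    Q≡ = ^-*-assoc q n n
    a≢0 : NonZero (length A)
    a≢0 = >-nonZero (≤-trans (m^n>0 q {{q≢0}} (n * n ∸ 1)) (≤-trans (m≤n*m (q ^ (n * n ∸ 1)) 4) large))
    a≤2b : length A ≤ 2 * length B
    a≤2b = half≤ {N = n * n} q≢0 (m*n≢0 n n {{n≢0}} {{n≢0}}) a≡b+r (subst (λ z → q * r ≤ 2 * z) Q≡ qr≤2Q) large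
    b≢0 : NonZero (length B)
    b≢0 = m*n≢0⇒n≢0 2 {{>-nonZero (≤-trans (>-nonZero⁻¹ (length A) {{a≢0}}) a≤2b)}}
    open Arithmetic a≢0 b≢0 a≤2b (m≤m⊔n (length S) (length P)) (m≤n⊔m (length S) (length P)) ∣A∣≤∣S∣
    conclude : _ → _ ⊎ _
    conclude (inj₁ h) = inj₂ (main-conclusion {∣ κ n ∣} {M = M} (subst (λ z → z * length A ^ 2 ≤ 2 * M ^ 3) Q≡ (main-term {Q} h)))
    conclude (inj₂ (ε , h , h′)) = inj₁ (error-conclusion n {q} {a} {M} {∣ κ n ∣} n≢0 q≢0
      (subst (λ z → q ^ n * (a * a * a * a) ≤ 8 * ∣ κ n ∣ * (z * z) * (M * M)) Q≡
        (error-term {Q} {q ^ n} {∣ κ n ∣} {ε} (subst NonZero (sym Q≡) (m^n≢0 q (n * n) {{q≢0}})) h h′)))
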